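{- Let $q=p^h$ with $p$ prime, let $a,b\in\mathbb{F}_q$, and let $n$ be a prime number with $n\neq 2,3$. If $n^2\not\equiv ab \pmod p$ (that is, the element $n^2\cdot 1\in\mathbb{F}_q$ is different from $ab$), then there exists a monic irreducible polynomial of degree $n$ over $\mathbb{F}_q$ of the form $X^n+c_1X^{n-1}+c_2X^{n-2}+\cdots+c_{n-1}X+c_n$ with $c_1=a$ and $c_{n-1}/c_n=b$. -}

module Defs where

open import Level using (Level; _⊔_)
open import Data.Nat using (ℕ; zero; suc; _≤_)
open import Data.Fin using (Fin)
open import Data.List using (List; []; _∷_; map; _++_; [_]; length; reverse)
open import Data.List.Relation.Binary.Pointwise using (Pointwise)
open import Data.Product using (∃; _×_)
open import Relation.Nullary using (¬_)
open import Relation.Binary.PropositionalEquality using (_≡_)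
open import Algebra.Bundles using (CommutativeRing)

record FiniteField (c ℓ : Level) (q : ℕ) : Set (Level.suc (c ⊔ ℓ)) where
  field
    commRing : CommutativeRing c ℓ
  open CommutativeRing commRing public
  field
    1≉0       : ¬ (1# ≈ 0#)
    inverse   : ∀ x → ¬ (x ≈ 0#) → ∃ λ y → x * y ≈ 1#
    enum      : Fin q → Carrier
    enum-inj  : ∀ i j → enum i ≈ enum j → i ≡ j
    enum-surj : ∀ x → ∃ λ i → enum i ≈ x

module Poly {c ℓ} (R : CommutativeRing c ℓ) where
  open CommutativeRing R

  -- Polynomials as coefficient lists, lowest degree first.
  addP : List Carrier → List Carrier → List Carrier
  addP [] ys = ys
  addP (x ∷ xs) [] = x ∷ xs
  addP (x ∷ xs) (y ∷ ys) = (x + y) ∷ addP xs ys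

  mulP : List Carrier → List Carrier → List Carrier
  mulP [] ys = []
  mulP (x ∷ xs) ys = addP (map (x *_) ys) (0# ∷ mulP xs ys)

  natR : ℕ → Carrier
  natR zero = 0#
  natR (suc n) = 1# + natR n

  -- monic (c₁ ∷ … ∷ cₖ ∷ []) is the coefficient list (lowest degree first)
  -- of the monic polynomial Xᵏ + c₁Xᵏ⁻¹ + ⋯ + cₖ₋₁X + cₖ of degree k.
  monic : List Carrier → List Carrier
  monic cs = reverse cs ++ [ 1# ]

  -- The monic polynomial with coefficient list cs (degree = length cs) is
  -- irreducible: it has positive degree and is not a product of two monic
  -- polynomials of positive degree (over a field every factorisation into
  -- non-units can be normalised to one into monic factors).
  IrreducibleMonic : List Carrier → Set (c ⊔ ℓ)
  IrreducibleMonic cs =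
    (1 ≤ length cs) ×
    (∀ (gs hs : List Carrier) → 1 ≤ length gs → 1 ≤ length hs →
       ¬ Pointwise _≈_ (mulP (monic gs) (monic hs)) (monic cs))

module Submission where

-- Call (c₁ , c_{d-1}/c_d) the class of a monic polynomial of degree d with nonzero constant
-- term. Classes add up under multiplication, and in degree d ≥ 3 they are equidistributed.
-- Writing deg f as the sum of the von Mangoldt weights of the divisors of f and summing over
-- f of degree m and given class gives, for the weighted number N_m(g) of prime powers of degree m
-- and class g, after the marginals of N_{m-2} have been computed in the same way,
--   N_m(a,b) + Σ_{c≠0} N_{m-1}(a-c, b-1/c) + q N_{m-2}(a,b) + [a=0] + [b=0] = 2 q^{m-2}   (m ≥ 3).
-- Since N ≥ 0, this bounds N_m(g) by 2 q^{m-2} from above. Iterating it once, and keeping in the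
-- double sum over c and d only the terms d = -c, bounds N_m(g) from below in terms of
-- N_{m-2}(g) and N_{m-4}(g), which together makes N_m(g) positive for m = 5 and m ≥ 7. For n
-- prime a prime power of degree n is irreducible or (X + c)^n, and the class (nc , n/c) of
-- the latter is excluded by n² ≠ ab.

open import Defs
open import Level using (0ℓ)
open import Algebra.Bundles using (CommutativeRing; RawRing)
open import Algebra.Core using (Op₁; Op₂)
open import Algebra.Morphism.Structures using (IsRingMonomorphism)
import Algebra.Morphism.RingMonomorphism as RingMonomorphism
import Algebra.Properties.Ring as RingProperties
open import Algebra.Structures using (IsCommutativeRing)
open import Data.Empty using (⊥-elim)
open import Data.Fin using (Fin)
import Data.Fin.Properties as Fin
open import Data.List using (List; []; _∷_; [_]; _++_; length; map; concatMap; reverse; upTo; applyUpTo; allFin; initLast; _∷ʳ′_)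
open import Data.List.Properties using (≡-dec; ∷-injective; length-map; length-reverse; map-++; reverse-++; reverse-involutive)
open import Data.List.Membership.Propositional using (_∈_; find; lose)
open import Data.List.Membership.Propositional.Properties using (∈-map⁺; ∈-map⁻; ∈-concatMap⁺; ∈-concatMap⁻; ∈-upTo⁺; ∈-allFin)
open import Data.List.Relation.Binary.Pointwise using (Pointwise; []; _∷_)
open import Data.List.Relation.Unary.All as All using (All; []; _∷_)
open import Data.List.Relation.Unary.AllPairs using ([]; _∷_)
open import Data.List.Relation.Unary.Any using (Any; any?; here; there)
open import Data.List.Relation.Unary.Unique.Propositional using (Unique)
open import Data.List.Relation.Unary.Unique.Propositional.Properties using (upTo⁺; allFin⁺)
open import Data.Maybe using (nothing)
import Data.Nat
open import Data.Nat using (ℕ; zero; suc; _+_; _∸_; _^_; _≤_; _<_; z≤n; s≤s; _≤?_; >-nonZero)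
open import Data.Nat.Divisibility using (divides)
open import Data.Nat.Primality using (Prime; prime⇒irreducible; ¬prime[0]; ¬prime[1])
import Data.Nat.Properties as ℕ
open import Data.Nat.Tactic.RingSolver using (solve-∀)
open import Data.Product using (∃; ∃-syntax; _×_; _,_; proj₁; proj₂)
open import Data.Sum using (_⊎_; inj₁; inj₂)
open import Function using (_∘_)
open import Relation.Binary.Definitions using (DecidableEquality)
open import Relation.Binary.PropositionalEquality
  using (_≡_; _≢_; _≗_; refl; sym; trans; cong; cong₂; subst; subst₂; module ≡-Reasoning)
open import Relation.Nullary using (¬_; Dec; yes; no; _×-dec_; ¬?)
open import Relation.Nullary.Decidable using (map′)
open import Tactic.RingSolver.Core.AlmostCommutativeRing using (fromCommutativeRing)
import Tactic.RingSolver.NonReflective as RingSolver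

-- The recurrence is Newton's identity for the L-series of the characters χ of the additive group K
-- × K. By equidistribution in degree 3 and above, this series is a polynomial in t for χ ≠ 1: it is
-- 1 + Kt + qt² with a Kloosterman sum K when χ is nontrivial on both coordinates, and 1 - t when χ
-- is trivial on exactly one. The coefficient q and the two indicator terms come from there. To stay
-- inside the natural numbers, characters are replaced by arbitrary test functions ψ with values in
-- ℕ, identities are written with their negative terms moved across, and the nonnegativity of prime
-- power counts takes the place of Weil's bound on K. The term of degree m - 1 in the recurrence
-- counts against a lower bound; expanded once more, it yields a term of degree m - 2, convolved
-- twice with the points (c , 1/c), which counts in favour. The resulting bound reaches down to
-- degree m - 4. The upper bound begins in degree 3 and so covers m - 4 when m ≥ 7, while for m = 5
-- the count in degree 1 is explicit.

-- Finite sums, indicators and diagonal sums of natural numbers.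

module Sums where
  open Data.Nat using (_*_)

  ∑ : {A : Set} → List A → (A → ℕ) → ℕ
  ∑ []       f = 0
  ∑ (x ∷ xs) f = f x + ∑ xs f

  syntax ∑ l (λ x → e) = ∑[ x ∈ l ] e
  infix 8 ∑

  ∑-cong-∈ : {A : Set} (l : List A) {f g : A → ℕ} → (∀ x → x ∈ l → f x ≡ g x) → ∑ l f ≡ ∑ l g
  ∑-cong-∈ []      e = refl
  ∑-cong-∈ (x ∷ l) e = cong₂ _+_ (e x (here refl)) (∑-cong-∈ l (λ y y∈l → e y (there y∈l)))

  ∑-cong : {A : Set} (l : List A) {f g : A → ℕ} → (∀ x → f x ≡ g x) → ∑ l f ≡ ∑ l g
  ∑-cong l e = ∑-cong-∈ l (λ x _ → e x)

  ∑-mono : {A : Set} (l : List A) {f g : A → ℕ} → (∀ x → f x ≤ g x) → ∑ l f ≤ ∑ l g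
  ∑-mono []      e = z≤n
  ∑-mono (x ∷ l) e = ℕ.+-mono-≤ (e x) (∑-mono l e)

  ∑-const : {A : Set} (l : List A) (c : ℕ) → ∑ l (λ _ → c) ≡ length l * c
  ∑-const []      c = refl
  ∑-const (x ∷ l) c = cong (c +_) (∑-const l c)

  ∑-zero : {A : Set} (l : List A) → ∑ l (λ _ → 0) ≡ 0
  ∑-zero l = trans (∑-const l 0) (ℕ.*-zeroʳ (length l))

  ∑-+ : {A : Set} (l : List A) (f g : A → ℕ) → ∑[ x ∈ l ] (f x + g x) ≡ ∑ l f + ∑ l g
  ∑-+ []      f g = refl
  ∑-+ (x ∷ l) f g = trans (cong (f x + g x +_) (∑-+ l f g)) (interchange (f x) (g x) (∑ l f) (∑ l g))
    where
    interchange : ∀ a b c d → (a + b) + (c + d) ≡ (a + c) + (b + d)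
    interchange = solve-∀

  ∑-*ˡ : {A : Set} (l : List A) (c : ℕ) (f : A → ℕ) → ∑[ x ∈ l ] (c * f x) ≡ c * ∑ l f
  ∑-*ˡ []      c f = sym (ℕ.*-zeroʳ c)
  ∑-*ˡ (x ∷ l) c f = trans (cong (c * f x +_) (∑-*ˡ l c f)) (sym (ℕ.*-distribˡ-+ c (f x) (∑ l f)))

  ∑-*ʳ : {A : Set} (l : List A) (c : ℕ) (f : A → ℕ) → ∑[ x ∈ l ] (f x * c) ≡ ∑ l f * c
  ∑-*ʳ l c f = trans (∑-cong l (λ x → ℕ.*-comm (f x) c)) (trans (∑-*ˡ l c f) (ℕ.*-comm c (∑ l f)))

  ∑-swap : {A B : Set} (l : List A) (m : List B) (f : A → B → ℕ) →
           ∑[ x ∈ l ] ∑[ y ∈ m ] f x y ≡ ∑[ y ∈ m ] ∑[ x ∈ l ] f x y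
  ∑-swap []      m f = sym (∑-zero m)
  ∑-swap (x ∷ l) m f = trans (cong (∑ m (f x) +_) (∑-swap l m f)) (sym (∑-+ m (f x) _))

  ∑-++ : {A : Set} (l m : List A) (f : A → ℕ) → ∑ (l ++ m) f ≡ ∑ l f + ∑ m f
  ∑-++ []      m f = refl
  ∑-++ (x ∷ l) m f = trans (cong (f x +_) (∑-++ l m f)) (sym (ℕ.+-assoc (f x) _ _))

  ∑-map : {A B : Set} (h : A → B) (l : List A) (f : B → ℕ) → ∑ (map h l) f ≡ ∑ l (f ∘ h)
  ∑-map h []      f = refl
  ∑-map h (x ∷ l) f = cong (f (h x) +_) (∑-map h l f)

  ∑-concatMap : {A B : Set} (h : A → List B) (l : List A) (f : B → ℕ) →
                ∑ (concatMap h l) f ≡ ∑[ x ∈ l ] ∑ (h x) f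
  ∑-concatMap h []      f = refl
  ∑-concatMap h (x ∷ l) f = trans (∑-++ (h x) (concatMap h l) f) (cong (∑ (h x) f +_) (∑-concatMap h l f))

  ∑-positive : {A : Set} (l : List A) (f : A → ℕ) → 0 < ∑ l f → ∃[ x ] x ∈ l × 0 < f x
  ∑-positive (x ∷ l) f p with f x in eq
  ... | suc k = x , here refl , subst (0 <_) (sym eq) (s≤s z≤n)
  ... | zero with ∑-positive l f p
  ...   | y , y∈l , q = y , there y∈l , q

  𝟙 : {P : Set} → Dec P → ℕ
  𝟙 (yes _) = 1
  𝟙 (no _)  = 0

  𝟙-yes : {P : Set} (d : Dec P) → P → 𝟙 d ≡ 1
  𝟙-yes (yes _) p = refl
  𝟙-yes (no ¬p) p = ⊥-elim (¬p p)

  𝟙-no : {P : Set} (d : Dec P) → ¬ P → 𝟙 d ≡ 0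
  𝟙-no (yes p) ¬p = ⊥-elim (¬p p)
  𝟙-no (no _)  ¬p = refl

  𝟙-cong : {P Q : Set} (d : Dec P) (e : Dec Q) → (P → Q) → (Q → P) → 𝟙 d ≡ 𝟙 e
  𝟙-cong (yes p) e f g = sym (𝟙-yes e (f p))
  𝟙-cong (no ¬p) e f g = sym (𝟙-no e (¬p ∘ g))

  𝟙-× : {P Q R : Set} (r : Dec R) (d : Dec P) (e : Dec Q) → (R → P × Q) → (P → Q → R) → 𝟙 r ≡ 𝟙 d * 𝟙 e
  𝟙-× r (yes p) (yes q) f g = 𝟙-yes r (g p q)
  𝟙-× r (yes p) (no ¬q) f g = 𝟙-no r (¬q ∘ proj₂ ∘ f)
  𝟙-× r (no ¬p) e       f g = 𝟙-no r (¬p ∘ proj₁ ∘ f)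

  𝟙-complement : {P : Set} (d : Dec P) → 𝟙 d + 𝟙 (¬? d) ≡ 1
  𝟙-complement (yes _) = refl
  𝟙-complement (no _)  = refl

  𝟙-subst : {P : Set} (d : Dec P) {a b : ℕ} → (P → a ≡ b) → 𝟙 d * a ≡ 𝟙 d * b
  𝟙-subst (yes p) e = cong (_+ 0) (e p)
  𝟙-subst (no _)  e = refl

  𝟙-positive : {P : Set} (d : Dec P) → 0 < 𝟙 d → P
  𝟙-positive (yes p) _ = p

  -- l lists every element of A exactly once.
  Enumerates : {A : Set} → DecidableEquality A → List A → Set
  Enumerates {A} _≟_ l = ∀ a (f : A → ℕ) → ∑[ x ∈ l ] (𝟙 (x ≟ a) * f x) ≡ f a

  module _ {A : Set} (_≟_ : DecidableEquality A) where
    open ≡-Reasoning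

    ∑-δ-∉ : ∀ l a (f : A → ℕ) → All (a ≢_) l → ∑[ x ∈ l ] (𝟙 (x ≟ a) * f x) ≡ 0
    ∑-δ-∉ []      a f []        = refl
    ∑-δ-∉ (x ∷ l) a f (n ∷ ns) =
      cong₂ _+_ (cong (_* f x) (𝟙-no (x ≟ a) (n ∘ sym))) (∑-δ-∉ l a f ns)

    ∑-δ : ∀ l a (f : A → ℕ) → Unique l → a ∈ l → ∑[ x ∈ l ] (𝟙 (x ≟ a) * f x) ≡ f a
    ∑-δ (x ∷ l) .x f (u ∷ us) (here refl) =
      trans (cong₂ _+_ (cong (_* f x) (𝟙-yes (x ≟ x) refl)) (∑-δ-∉ l x f u)) (id′ (f x))
      where
      id′ : ∀ n → 1 * n + 0 ≡ n
      id′ = solve-∀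
    ∑-δ (x ∷ l) a f (u ∷ us) (there a∈l) =
      cong₂ _+_ (cong (_* f x) (𝟙-no (x ≟ a) (All.lookup u a∈l))) (∑-δ l a f us a∈l)

    ∑-reindex : ∀ {l} → Enumerates _≟_ l → (φ φ⁻¹ : A → A) → (∀ x → φ⁻¹ (φ x) ≡ x) → (∀ x → φ (φ⁻¹ x) ≡ x) →
                (f : A → ℕ) → ∑ l (f ∘ φ) ≡ ∑ l f
    ∑-reindex {l} enum φ φ⁻¹ invˡ invʳ f = begin
      ∑ l (f ∘ φ)                                        ≡⟨ ∑-cong l (λ x → enum (φ x) f) ⟨
      ∑[ x ∈ l ] ∑[ y ∈ l ] (𝟙 (y ≟ φ x) * f y)          ≡⟨ ∑-swap l l _ ⟩
      ∑[ y ∈ l ] ∑[ x ∈ l ] (𝟙 (y ≟ φ x) * f y)          ≡⟨ ∑-cong l (λ y → ∑-cong l (λ x → cong (_* f y)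
                                                             (𝟙-cong (y ≟ φ x) (x ≟ φ⁻¹ y)
                                                               (λ e → trans (sym (invˡ x)) (cong φ⁻¹ (sym e)))
                                                               (λ e → trans (sym (invʳ y)) (cong φ (sym e)))))) ⟩
      ∑[ y ∈ l ] ∑[ x ∈ l ] (𝟙 (x ≟ φ⁻¹ y) * f y)        ≡⟨ ∑-cong l (λ y → enum (φ⁻¹ y) (λ _ → f y)) ⟩
      ∑ l f                                              ∎

  ∑-applyUpTo : (g : ℕ → ℕ) (n : ℕ) (F : ℕ → ℕ) → ∑ (applyUpTo g n) F ≡ ∑ (upTo n) (F ∘ g)
  ∑-applyUpTo g zero    F = refl
  ∑-applyUpTo g (suc n) F =
    cong (F (g 0) +_) (trans (∑-applyUpTo (g ∘ suc) n F) (sym (∑-applyUpTo suc n (F ∘ g))))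

  -- Both sides are the sum of `F` over 0, ..., n. It absorbs the index shift in `valuation-same`.
  ∑-upTo-shift : (n : ℕ) (F : ℕ → ℕ) → ∑ (upTo n) F + F n ≡ F 0 + ∑ (upTo n) (F ∘ suc)
  ∑-upTo-shift zero    F = sym (ℕ.+-identityʳ (F 0))
  ∑-upTo-shift (suc n) F = begin
    F 0 + ∑ (applyUpTo suc n) F + F (suc n)     ≡⟨ cong (λ s → F 0 + s + F (suc n)) (∑-applyUpTo suc n F) ⟩
    F 0 + ∑ (upTo n) (F ∘ suc) + F (suc n)      ≡⟨ ℕ.+-assoc (F 0) _ _ ⟩
    F 0 + (∑ (upTo n) (F ∘ suc) + F (suc n))    ≡⟨ cong (F 0 +_) (∑-upTo-shift n (F ∘ suc)) ⟩
    F 0 + (F 1 + ∑ (upTo n) (F ∘ suc ∘ suc))    ≡⟨ cong (λ s → F 0 + (F 1 + s)) (∑-applyUpTo suc n (F ∘ suc)) ⟨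
    F 0 + ∑ (upTo (suc n)) (F ∘ suc)            ∎
    where open ≡-Reasoning

  -- diag c m is the sum of c j i over j + i = m with j ≥ 1.
  diag : (ℕ → ℕ → ℕ) → ℕ → ℕ
  diag c zero    = 0
  diag c (suc m) = c (suc m) 0 + diag (λ j i → c j (suc i)) m

  diag-cong : ∀ {c d} m → (∀ j i → c j i ≡ d j i) → diag c m ≡ diag d m
  diag-cong zero    e = refl
  diag-cong (suc m) e = cong₂ _+_ (e (suc m) 0) (diag-cong m (λ j i → e j (suc i)))

  diag-*ʳ : ∀ c a m → diag (λ j i → c j i * a) m ≡ diag c m * a
  diag-*ʳ c a zero    = refl
  diag-*ʳ c a (suc m) = trans (cong (c (suc m) 0 * a +_) (diag-*ʳ (λ j i → c j (suc i)) a m))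
                              (sym (ℕ.*-distribʳ-+ a (c (suc m) 0) _))

  ∑-diag : {A : Set} (l : List A) (a : A → ℕ) (c : A → ℕ → ℕ → ℕ) (m : ℕ) →
           ∑[ x ∈ l ] (a x * diag (c x) m) ≡ diag (λ j i → ∑[ x ∈ l ] (a x * c x j i)) m
  ∑-diag l a c zero    = trans (∑-cong l (λ x → ℕ.*-zeroʳ (a x))) (∑-zero l)
  ∑-diag l a c (suc m) =
    trans (∑-cong l (λ x → ℕ.*-distribˡ-+ (a x) _ _))
          (trans (∑-+ l _ _) (cong (∑[ x ∈ l ] (a x * c x (suc m) 0) +_) (∑-diag l a (λ x j i → c x j (suc i)) m)))

  -- Pinning the first index to l leaves at most the pair (l , m - l) on the diagonal, and none when
  -- m < l; `diag-δ-≤` is the other case.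
  diag-δ-> : ∀ m l (c : ℕ → ℕ) → m < l → diag (λ j i → 𝟙 (l ℕ.≟ j) * c i) m ≡ 0
  diag-δ-> zero    l c m<l = refl
  diag-δ-> (suc m) l c m<l = cong₂ _+_ (cong (_* c 0) (𝟙-no (l ℕ.≟ suc m) (λ { refl → ℕ.<-irrefl refl m<l })))
                                       (diag-δ-> m l (c ∘ suc) (ℕ.<-trans (ℕ.n<1+n m) m<l))

  diag-δ-≤ : ∀ i l (c : ℕ → ℕ) → diag (λ j i → 𝟙 (suc l ℕ.≟ j) * c i) (i + suc l) ≡ c i
  diag-δ-≤ zero    l c = trans (cong₂ _+_ (trans (cong (_* c 0) (𝟙-yes (suc l ℕ.≟ suc l) refl)) (ℕ.*-identityˡ (c 0)))
                                          (diag-δ-> l (suc l) (c ∘ suc) ℕ.≤-refl)) (ℕ.+-identityʳ _)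
  diag-δ-≤ (suc i) l c = cong₂ _+_ (cong (_* c 0) (𝟙-no (suc l ℕ.≟ suc (i + suc l)) (ℕ.<⇒≢ (s≤s (ℕ.m≤n+m (suc l) i)))))
                                   (diag-δ-≤ i l (c ∘ suc))

open Sums

-- Finite fields with decidable propositional equality and a list of elements.

record FiniteFieldOn (K : Set) : Set where
  infixl 6 _⊕_
  infixl 7 _⊙_
  infix  8 ⊖_ _⁻¹
  infix  4 _≟ᴷ_
  field
    _⊕_ _⊙_           : Op₂ K
    ⊖_ _⁻¹            : Op₁ K
    𝟎 𝟏               : K
    isCommutativeRing : IsCommutativeRing _≡_ _⊕_ _⊙_ ⊖_ 𝟎 𝟏
    𝟏≢𝟎               : 𝟏 ≢ 𝟎
    ⊙-inverseʳ        : ∀ x → x ≢ 𝟎 → x ⊙ x ⁻¹ ≡ 𝟏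
    -- This value makes inversion an involution of all of K, so sums over K can be reindexed along
    -- it.
    𝟎⁻¹≡𝟎             : 𝟎 ⁻¹ ≡ 𝟎
    _≟ᴷ_              : DecidableEquality K
    elements          : List K
    ∈-elements        : ∀ x → x ∈ elements
    enumerates        : Enumerates _≟ᴷ_ elements

-- Power series, degree bounds and division with remainder.

module PowerSeries {K : Set} (𝔽 : FiniteFieldOn K) where
  open Data.Nat using (_*_)
  open ≡-Reasoning
  open FiniteFieldOn 𝔽 public
  open IsCommutativeRing isCommutativeRing public
    using (+-assoc; +-comm; +-identityˡ; +-identityʳ; -‿inverseˡ; -‿inverseʳ;
           *-assoc; *-comm; *-identityˡ; *-identityʳ; distribˡ; distribʳ; zeroˡ; zeroʳ)
  commutativeRing : CommutativeRing 0ℓ 0ℓ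
  commutativeRing = record { isCommutativeRing = isCommutativeRing }
  open RingProperties (CommutativeRing.ring commutativeRing) public
    using () renaming (+-cancelʳ to ⊕-cancelʳ)

  ⊕-exchange : ∀ a b c d → (a ⊕ b) ⊕ (c ⊕ d) ≡ (a ⊕ c) ⊕ (b ⊕ d)
  ⊕-exchange a b c d = begin
    (a ⊕ b) ⊕ (c ⊕ d)  ≡⟨ +-assoc a b (c ⊕ d) ⟩
    a ⊕ (b ⊕ (c ⊕ d))  ≡⟨ cong (a ⊕_) (+-assoc b c d) ⟨
    a ⊕ (b ⊕ c ⊕ d)    ≡⟨ cong (λ x → a ⊕ (x ⊕ d)) (+-comm b c) ⟩
    a ⊕ (c ⊕ b ⊕ d)    ≡⟨ cong (a ⊕_) (+-assoc c b d) ⟩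
    a ⊕ (c ⊕ (b ⊕ d))  ≡⟨ +-assoc a c (b ⊕ d) ⟨
    (a ⊕ c) ⊕ (b ⊕ d)  ∎

  -- Polynomials are series with a degree bound as a side condition: products are defined by plain
  -- recursion on the index, and trailing zeros cause no ambiguity.
  Series : Set
  Series = ℕ → K

  infixl 6 _+ₛ_
  infixl 7 _*ₛ_ _·_

  _+ₛ_ : Series → Series → Series
  (f +ₛ g) n = f n ⊕ g n

  -ₛ_ : Series → Series
  (-ₛ f) n = ⊖ f n

  _·_ : K → Series → Series
  (c · f) n = c ⊙ f n

  0ₛ : Series
  0ₛ _ = 𝟎

  _*ₛ_ : Series → Series → Series
  (f *ₛ g) zero    = f 0 ⊙ g 0
  (f *ₛ g) (suc n) = f 0 ⊙ g (suc n) ⊕ ((f ∘ suc) *ₛ g) n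

  *ₛ-cong : ∀ {f f′ g g′} → f ≗ f′ → g ≗ g′ → f *ₛ g ≗ f′ *ₛ g′
  *ₛ-cong p r zero    = cong₂ _⊙_ (p 0) (r 0)
  *ₛ-cong p r (suc n) = cong₂ _⊕_ (cong₂ _⊙_ (p 0) (r (suc n))) (*ₛ-cong (p ∘ suc) r n)

  *ₛ-congˡ : ∀ f {g g′} → g ≗ g′ → f *ₛ g ≗ f *ₛ g′
  *ₛ-congˡ f = *ₛ-cong {f} (λ _ → refl)

  *ₛ-congʳ : ∀ {f f′} g → f ≗ f′ → f *ₛ g ≗ f′ *ₛ g
  *ₛ-congʳ g p = *ₛ-cong {g = g} p (λ _ → refl)

  *ₛ-sucʳ : ∀ f g n → (f *ₛ g) (suc n) ≡ (f *ₛ (g ∘ suc)) n ⊕ f (suc n) ⊙ g 0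
  *ₛ-sucʳ f g zero    = refl
  *ₛ-sucʳ f g (suc n) = trans (cong (f 0 ⊙ g (2 + n) ⊕_) (*ₛ-sucʳ (f ∘ suc) g n)) (sym (+-assoc _ _ _))

  *ₛ-comm : ∀ f g → f *ₛ g ≗ g *ₛ f
  *ₛ-comm f g zero    = *-comm _ _
  *ₛ-comm f g (suc n) = begin
    f 0 ⊙ g (suc n) ⊕ ((f ∘ suc) *ₛ g) n    ≡⟨ +-comm _ _ ⟩
    ((f ∘ suc) *ₛ g) n ⊕ f 0 ⊙ g (suc n)    ≡⟨ cong₂ _⊕_ (*ₛ-comm (f ∘ suc) g n) (*-comm _ _) ⟩
    (g *ₛ (f ∘ suc)) n ⊕ g (suc n) ⊙ f 0    ≡⟨ *ₛ-sucʳ g f n ⟨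
    (g *ₛ f) (suc n)                        ∎

  *ₛ-distribʳ : ∀ h f g → (f +ₛ g) *ₛ h ≗ f *ₛ h +ₛ g *ₛ h
  *ₛ-distribʳ h f g zero    = distribʳ _ _ _
  *ₛ-distribʳ h f g (suc n) =
    trans (cong₂ _⊕_ (distribʳ _ _ _) (*ₛ-distribʳ h (f ∘ suc) (g ∘ suc) n)) (⊕-exchange _ _ _ _)

  ·-*ₛ : ∀ c f g → (c · f) *ₛ g ≗ c · (f *ₛ g)
  ·-*ₛ c f g zero    = *-assoc _ _ _
  ·-*ₛ c f g (suc n) =
    trans (cong₂ _⊕_ (*-assoc _ _ _) (·-*ₛ c (f ∘ suc) g n)) (sym (distribˡ _ _ _))

  *ₛ-assoc : ∀ f g h → (f *ₛ g) *ₛ h ≗ f *ₛ (g *ₛ h)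
  *ₛ-assoc f g h zero    = *-assoc _ _ _
  *ₛ-assoc f g h (suc n) = begin
    f 0 ⊙ g 0 ⊙ h (suc n) ⊕ ((f 0 · (g ∘ suc) +ₛ (f ∘ suc) *ₛ g) *ₛ h) n
      ≡⟨ cong₂ _⊕_ (*-assoc _ _ _) (*ₛ-distribʳ h (f 0 · (g ∘ suc)) ((f ∘ suc) *ₛ g) n) ⟩
    f 0 ⊙ (g 0 ⊙ h (suc n)) ⊕ (((f 0 · (g ∘ suc)) *ₛ h) n ⊕ (((f ∘ suc) *ₛ g) *ₛ h) n)
      ≡⟨ cong (f 0 ⊙ (g 0 ⊙ h (suc n)) ⊕_) (cong₂ _⊕_ (·-*ₛ (f 0) (g ∘ suc) h n) (*ₛ-assoc (f ∘ suc) g h n)) ⟩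
    f 0 ⊙ (g 0 ⊙ h (suc n)) ⊕ (f 0 ⊙ ((g ∘ suc) *ₛ h) n ⊕ ((f ∘ suc) *ₛ (g *ₛ h)) n)
      ≡⟨ +-assoc _ _ _ ⟨
    f 0 ⊙ (g 0 ⊙ h (suc n)) ⊕ f 0 ⊙ ((g ∘ suc) *ₛ h) n ⊕ ((f ∘ suc) *ₛ (g *ₛ h)) n
      ≡⟨ cong (_⊕ ((f ∘ suc) *ₛ (g *ₛ h)) n) (distribˡ _ _ _) ⟨
    f 0 ⊙ (g *ₛ h) (suc n) ⊕ ((f ∘ suc) *ₛ (g *ₛ h)) n
      ∎

  *ₛ-zeroˡ : ∀ {f} g → f ≗ 0ₛ → f *ₛ g ≗ 0ₛ
  *ₛ-zeroˡ g p zero    = trans (cong (_⊙ g 0) (p 0)) (zeroˡ _)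
  *ₛ-zeroˡ g p (suc n) =
    trans (cong₂ _⊕_ (trans (cong (_⊙ g (suc n)) (p 0)) (zeroˡ _)) (*ₛ-zeroˡ g (p ∘ suc) n)) (+-identityˡ _)

  Deg< : ℕ → Series → Set
  Deg< d f = ∀ i → d ≤ i → f i ≡ 𝟎

  Poly : Series → Set
  Poly f = ∃[ d ] Deg< d f

  Monic : ℕ → Series → Set
  Monic d f = f d ≡ 𝟏 × Deg< (suc d) f

  Deg<-tail : ∀ {d f} → Deg< (suc d) f → Deg< d (f ∘ suc)
  Deg<-tail p i d≤i = p (suc i) (s≤s d≤i)

  -- One bound is exclusive and the other inclusive, which gives the sharp bound for the product
  -- without subtraction.
  deg-* : ∀ m n f g → Deg< m f → Deg< (suc n) g → Deg< (m + n) (f *ₛ g)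
  deg-* zero    n f g p r i       _         = *ₛ-zeroˡ g (λ j → p j z≤n) i
  deg-* (suc m) n f g p r (suc i) (s≤s m+n≤i) =
    trans (cong₂ _⊕_ (trans (cong (f 0 ⊙_) (r (suc i) (s≤s (ℕ.≤-trans (ℕ.m≤n+m n m) m+n≤i)))) (zeroʳ _))
                     (deg-* m n (f ∘ suc) g (Deg<-tail {f = f} p) r i m+n≤i))
          (+-identityˡ _)

  lead-* : ∀ m n f g → Deg< (suc m) f → Deg< (suc n) g → (f *ₛ g) (m + n) ≡ f m ⊙ g n
  lead-* zero    zero    f g p r = refl
  lead-* zero    (suc n) f g p r =
    trans (cong (f 0 ⊙ g (suc n) ⊕_) (*ₛ-zeroˡ g (λ j → p (suc j) (s≤s z≤n)) n)) (+-identityʳ _)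
  lead-* (suc m) n f g p r =
    trans (cong₂ _⊕_ (trans (cong (f 0 ⊙_) (r (suc (m + n)) (s≤s (ℕ.m≤n+m n m)))) (zeroʳ _))
                     (lead-* m n (f ∘ suc) g (Deg<-tail {f = f} p) r))
          (+-identityˡ _)

  Deg<-weaken : ∀ {d e f} → d ≤ e → Deg< d f → Deg< e f
  Deg<-weaken d≤e p i e≤i = p i (ℕ.≤-trans d≤e e≤i)

  Poly-* : ∀ {f g} → Poly f → Poly g → Poly (f *ₛ g)
  Poly-* {f} {g} (d , p) (e , r) = d + e , deg-* d e f g p (Deg<-weaken {f = g} (ℕ.n≤1+n e) r)

  Poly-+ : ∀ {f g} → Poly f → Poly g → Poly (f +ₛ g)
  Poly-+ (d , p) (e , r) = d + e , λ i le →
    trans (cong₂ _⊕_ (p i (ℕ.m+n≤o⇒m≤o d le)) (r i (ℕ.m+n≤o⇒n≤o d le))) (+-identityˡ _)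

  ⊖𝟎≡𝟎 : ⊖ 𝟎 ≡ 𝟎
  ⊖𝟎≡𝟎 = trans (sym (+-identityˡ _)) (-‿inverseʳ 𝟎)

  Poly-neg : ∀ {f} → Poly f → Poly (-ₛ f)
  Poly-neg (d , p) = d , λ i le → trans (cong ⊖_ (p i le)) ⊖𝟎≡𝟎

  Poly-· : ∀ {f} c → Poly f → Poly (c · f)
  Poly-· c (d , p) = d , λ i le → trans (cong (c ⊙_) (p i le)) (zeroʳ c)

  -- Scanning down from the bound finds the leading coefficient. This is how a remainder is
  -- recognised as zero or made monic.
  top : ∀ d f → Deg< d f → (f ≗ 0ₛ) ⊎ (∃[ j ] j < d × f j ≢ 𝟎 × Deg< (suc j) f)
  top zero    f p = inj₁ (λ i → p i z≤n)
  top (suc d) f p with f d ≟ᴷ 𝟎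
  ... | no  fd≢𝟎 = inj₂ (d , ℕ.≤-refl , fd≢𝟎 , p)
  ... | yes fd≡𝟎 with top d f (λ i d≤i → lower i (ℕ.m≤n⇒m<n∨m≡n d≤i))
    where
    lower : ∀ i → d < i ⊎ d ≡ i → f i ≡ 𝟎
    lower i (inj₁ d<i)  = p i d<i
    lower i (inj₂ refl) = fd≡𝟎
  ...   | inj₁ z                  = inj₁ z
  ...   | inj₂ (j , j<d , nz , r) = inj₂ (j , ℕ.m<n⇒m<1+n j<d , nz , r)

  cons : K → Series → Series
  cons c f zero    = c
  cons c f (suc n) = f n

  ⊕-⊖-cancel : ∀ x y → y ⊕ (x ⊕ ⊖ y) ≡ x
  ⊕-⊖-cancel x y = begin
    y ⊕ (x ⊕ ⊖ y)  ≡⟨ cong (y ⊕_) (+-comm x (⊖ y)) ⟩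
    y ⊕ (⊖ y ⊕ x)  ≡⟨ +-assoc y (⊖ y) x ⟨
    y ⊕ ⊖ y ⊕ x    ≡⟨ cong (_⊕ x) (-‿inverseʳ y) ⟩
    𝟎 ⊕ x          ≡⟨ +-identityˡ x ⟩
    x              ∎

  -- Horner's scheme: if the tail of f is s·g + r, then f = (X·s + c)·g + (X·r + f(0) - c·g). The
  -- choice `c = r e` cancels the only coefficient, in degree e + 1, by which X·r may exceed the
  -- allowed degree.
  divMod : ∀ {e g} → Monic (suc e) g → ∀ d f → Deg< d f →
           ∃[ s ] ∃[ r ] Poly s × Deg< (suc e) r × f ≗ s *ₛ g +ₛ r
  divMod {e} {g} _ zero f p =
    0ₛ , 0ₛ , (0 , λ _ _ → refl) , (λ _ _ → refl) ,
    λ i → trans (p i z≤n) (sym (trans (+-identityʳ _) (*ₛ-zeroˡ {0ₛ} g (λ _ → refl) i)))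
  divMod {e} {g} mon@(g≡𝟏 , gdeg) (suc d) f p
    with divMod mon d (f ∘ suc) (Deg<-tail {f = f} p)
  ... | s , r , (k , sdeg) , rdeg , eq =
    cons c s , r′ , (suc k , λ { (suc i) (s≤s le) → sdeg i le }) , deg , eq′
    where
    c = r e
    r′ = cons (f 0) r +ₛ -ₛ (c · g)
    vanish : ∀ i → e < i ⊎ e ≡ i → r′ (suc i) ≡ 𝟎
    vanish i (inj₁ e<i) = trans (cong₂ (λ x y → x ⊕ ⊖ (c ⊙ y)) (rdeg i e<i) (gdeg (suc i) (s≤s e<i)))
                                (trans (+-identityˡ _) (trans (cong ⊖_ (zeroʳ c)) ⊖𝟎≡𝟎))
    vanish i (inj₂ refl) = trans (cong (λ x → c ⊕ ⊖ x) (trans (cong (c ⊙_) g≡𝟏) (*-identityʳ c))) (-‿inverseʳ c)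
    deg : Deg< (suc e) r′
    deg (suc i) (s≤s e≤i) = vanish i (ℕ.m≤n⇒m<n∨m≡n e≤i)
    eq′ : f ≗ cons c s *ₛ g +ₛ r′
    eq′ zero    = sym (⊕-⊖-cancel (f 0) (c ⊙ g 0))
    eq′ (suc n) = begin
      f (suc n)                                                     ≡⟨ eq n ⟩
      (s *ₛ g) n ⊕ r n                                              ≡⟨ cong ((s *ₛ g) n ⊕_) (⊕-⊖-cancel (r n) (c ⊙ g (suc n))) ⟨
      (s *ₛ g) n ⊕ (c ⊙ g (suc n) ⊕ (r n ⊕ ⊖ (c ⊙ g (suc n))))      ≡⟨ +-assoc _ _ _ ⟨
      (s *ₛ g) n ⊕ c ⊙ g (suc n) ⊕ (r n ⊕ ⊖ (c ⊙ g (suc n)))        ≡⟨ cong (_⊕ r′ (suc n)) (+-comm _ _) ⟩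
      (cons c s *ₛ g) (suc n) ⊕ r′ (suc n)                          ∎

  normalise : ∀ {d f} → f d ≢ 𝟎 → Deg< (suc d) f → Monic d ((f d) ⁻¹ · f)
  normalise {d} {f} nz p =
    trans (*-comm _ _) (⊙-inverseʳ (f d) nz) , λ i le → trans (cong ((f d) ⁻¹ ⊙_) (p i le)) (zeroʳ _)

  -- The leading coefficient of s reappears in s·g at degree j + e because g is monic. Being
  -- nonzero, it must be the leading 1 of f.
  monic-cofactor : ∀ {d e s g f} → Monic e g → Monic d f → Poly s → s *ₛ g ≗ f → ∃[ j ] Monic j s × j + e ≡ d
  monic-cofactor {d} {e} {s} {g} {f} (g≡𝟏 , gdeg) (f≡𝟏 , fdeg) (k , sdeg) eq with top k s sdeg
  ... | inj₁ z = ⊥-elim (𝟏≢𝟎 (trans (sym f≡𝟏) (trans (sym (eq d)) (*ₛ-zeroˡ g z d))))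
  ... | inj₂ (j , _ , nz , sdeg′) = j , (sj≡𝟏 , sdeg′) , j+e≡d
    where
    fj+e : f (j + e) ≡ s j
    fj+e = trans (sym (eq (j + e))) (trans (lead-* j e s g sdeg′ gdeg) (trans (cong (s j ⊙_) g≡𝟏) (*-identityʳ _)))
    j+e≤d : j + e ≤ d
    j+e≤d = ℕ.≮⇒≥ (λ d<j+e → nz (trans (sym fj+e) (fdeg (j + e) d<j+e)))
    d≤j+e : d ≤ j + e
    d≤j+e = ℕ.≮⇒≥ (λ j+e<d → 𝟏≢𝟎 (trans (sym f≡𝟏) (trans (sym (eq d)) (deg-* (suc j) e s g sdeg′ gdeg d j+e<d))))
    j+e≡d : j + e ≡ d
    j+e≡d = ℕ.≤-antisym j+e≤d d≤j+e
    sj≡𝟏 : s j ≡ 𝟏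
    sj≡𝟏 = trans (sym fj+e) (trans (cong f j+e≡d) f≡𝟏)

  infix 4 _∣ₛ_
  -- Cofactors need not be monic here, since Euclid's argument scales and subtracts; `∣ₛ⇒∣` returns
  -- to monic cofactors.
  _∣ₛ_ : Series → Series → Set
  p ∣ₛ f = ∃[ s ] Poly s × s *ₛ p ≗ f

  ∣ₛ-difference : ∀ {p x y z} → Poly y → Poly z → x +ₛ y *ₛ p ≗ z *ₛ p → p ∣ₛ x
  ∣ₛ-difference {p} {x} {y} {z} Py Pz eq = z +ₛ -ₛ y , Poly-+ {z} { -ₛ y} Pz (Poly-neg {y} Py) , λ i →
    ⊕-cancelʳ ((y *ₛ p) i) _ _ (begin
      ((z +ₛ -ₛ y) *ₛ p) i ⊕ (y *ₛ p) i    ≡⟨ *ₛ-distribʳ p (z +ₛ -ₛ y) y i ⟨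
      (((z +ₛ -ₛ y) +ₛ y) *ₛ p) i          ≡⟨ *ₛ-congʳ p (λ j → trans (+-comm _ (y j)) (⊕-⊖-cancel (z j) (y j))) i ⟩
      (z *ₛ p) i                           ≡⟨ eq i ⟨
      x i ⊕ (y *ₛ p) i                     ∎)

  ∣ₛ-· : ∀ {p f} c → p ∣ₛ f → p ∣ₛ c · f
  ∣ₛ-· {p} c (s , Ps , eq) = c · s , Poly-· {s} c Ps , λ i → trans (·-*ₛ c s p i) (cong (c ⊙_) (eq i))

  monic₀-identity : ∀ {g} h → Monic 0 g → g *ₛ h ≗ h
  monic₀-identity h (g≡𝟏 , gdeg) zero    = trans (cong (_⊙ h 0) g≡𝟏) (*-identityˡ _)
  monic₀-identity {g} h (g≡𝟏 , gdeg) (suc n) =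
    trans (cong₂ _⊕_ (trans (cong (_⊙ h (suc n)) g≡𝟏) (*-identityˡ _))
                     (*ₛ-zeroˡ {g ∘ suc} h (λ i → gdeg (suc i) (s≤s z≤n)) n))
          (+-identityʳ _)

  ∣ₛ-resp : ∀ {p f f′} → f ≗ f′ → p ∣ₛ f → p ∣ₛ f′
  ∣ₛ-resp e (s , Ps , eq) = s , Ps , λ i → trans (eq i) (e i)

-- Monic polynomials, Euclid's lemma, and the degree as a sum over prime powers.

module MonicPolynomials {K : Set} (𝔽 : FiniteFieldOn K) where
  open Data.Nat using (_*_)
  open ≡-Reasoning
  open PowerSeries 𝔽 public

  infix 4 _≟_
  _≟_ : DecidableEquality (List K)
  _≟_ = ≡-dec _≟ᴷ_

  -- A list of length d holds the non-leading coefficients, lowest degree first,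
  -- of a monic polynomial of degree d.
  ⟦_⟧ : List K → Series
  ⟦ [] ⟧     zero    = 𝟏
  ⟦ [] ⟧     (suc n) = 𝟎
  ⟦ x ∷ xs ⟧ zero    = x
  ⟦ x ∷ xs ⟧ (suc n) = ⟦ xs ⟧ n

  prefix : ℕ → Series → List K
  prefix zero    f = []
  prefix (suc d) f = f 0 ∷ prefix d (f ∘ suc)

  length-prefix : ∀ d f → length (prefix d f) ≡ d
  length-prefix zero    f = refl
  length-prefix (suc d) f = cong suc (length-prefix d (f ∘ suc))

  ⟦⟧-monic : ∀ xs → Monic (length xs) ⟦ xs ⟧
  ⟦⟧-monic []       = refl , λ { (suc i) _ → refl }
  ⟦⟧-monic (x ∷ xs) = proj₁ (⟦⟧-monic xs) , λ { (suc i) (s≤s le) → proj₂ (⟦⟧-monic xs) i le }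

  ⟦⟧-poly : ∀ xs → Poly ⟦ xs ⟧
  ⟦⟧-poly xs = suc (length xs) , proj₂ (⟦⟧-monic xs)

  ⟦prefix⟧ : ∀ {d f} → Monic d f → ⟦ prefix d f ⟧ ≗ f
  ⟦prefix⟧ {zero}      (f≡𝟏 , p) zero    = sym f≡𝟏
  ⟦prefix⟧ {zero}      (f≡𝟏 , p) (suc n) = sym (p (suc n) (s≤s z≤n))
  ⟦prefix⟧ {suc d}     m         zero    = refl
  ⟦prefix⟧ {suc d} {f} (f≡𝟏 , p) (suc n) = ⟦prefix⟧ {d} {f ∘ suc} (f≡𝟏 , Deg<-tail {f = f} p) n

  ⟦⟧-injective : ∀ {xs ys} → ⟦ xs ⟧ ≗ ⟦ ys ⟧ → xs ≡ ys
  ⟦⟧-injective {[]}     {[]}     e = refl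
  ⟦⟧-injective {[]}     {y ∷ ys} e = ⊥-elim (𝟏≢𝟎 (sym (trans (e (suc (length ys))) (proj₁ (⟦⟧-monic ys)))))
  ⟦⟧-injective {x ∷ xs} {[]}     e = ⊥-elim (𝟏≢𝟎 (trans (sym (proj₁ (⟦⟧-monic xs))) (e (suc (length xs)))))
  ⟦⟧-injective {x ∷ xs} {y ∷ ys} e = cong₂ _∷_ (e 0) (⟦⟧-injective (e ∘ suc))

  infixr 7 _⊗_
  _⊗_ : List K → List K → List K
  xs ⊗ ys = prefix (length xs + length ys) (⟦ xs ⟧ *ₛ ⟦ ys ⟧)

  length-⊗ : ∀ xs ys → length (xs ⊗ ys) ≡ length xs + length ys
  length-⊗ xs ys = length-prefix (length xs + length ys) _

  ⟦⊗⟧ : ∀ xs ys → ⟦ xs ⊗ ys ⟧ ≗ ⟦ xs ⟧ *ₛ ⟦ ys ⟧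
  ⟦⊗⟧ xs ys = ⟦prefix⟧
    ( trans (lead-* (length xs) (length ys) _ _ (proj₂ (⟦⟧-monic xs)) (proj₂ (⟦⟧-monic ys)))
            (trans (cong₂ _⊙_ (proj₁ (⟦⟧-monic xs)) (proj₁ (⟦⟧-monic ys))) (*-identityˡ 𝟏))
    , deg-* (suc (length xs)) (length ys) _ _ (proj₂ (⟦⟧-monic xs)) (proj₂ (⟦⟧-monic ys)) )

  ⊗-comm : ∀ xs ys → xs ⊗ ys ≡ ys ⊗ xs
  ⊗-comm xs ys = ⟦⟧-injective λ i →
    trans (⟦⊗⟧ xs ys i) (trans (*ₛ-comm ⟦ xs ⟧ ⟦ ys ⟧ i) (sym (⟦⊗⟧ ys xs i)))

  ⊗-assoc : ∀ xs ys zs → (xs ⊗ ys) ⊗ zs ≡ xs ⊗ ys ⊗ zs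
  ⊗-assoc xs ys zs = ⟦⟧-injective λ i → begin
    ⟦ (xs ⊗ ys) ⊗ zs ⟧ i                ≡⟨ ⟦⊗⟧ (xs ⊗ ys) zs i ⟩
    (⟦ xs ⊗ ys ⟧ *ₛ ⟦ zs ⟧) i           ≡⟨ *ₛ-congʳ ⟦ zs ⟧ (⟦⊗⟧ xs ys) i ⟩
    ((⟦ xs ⟧ *ₛ ⟦ ys ⟧) *ₛ ⟦ zs ⟧) i    ≡⟨ *ₛ-assoc ⟦ xs ⟧ ⟦ ys ⟧ ⟦ zs ⟧ i ⟩
    (⟦ xs ⟧ *ₛ (⟦ ys ⟧ *ₛ ⟦ zs ⟧)) i    ≡⟨ *ₛ-congˡ ⟦ xs ⟧ (⟦⊗⟧ ys zs) i ⟨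
    (⟦ xs ⟧ *ₛ ⟦ ys ⊗ zs ⟧) i           ≡⟨ ⟦⊗⟧ xs (ys ⊗ zs) i ⟨
    ⟦ xs ⊗ ys ⊗ zs ⟧ i                  ∎

  ⊗-identityˡ : ∀ xs → [] ⊗ xs ≡ xs
  ⊗-identityˡ xs = ⟦⟧-injective λ i → trans (⟦⊗⟧ [] xs i) (monic₀-identity ⟦ xs ⟧ (⟦⟧-monic []) i)

  ⊗-identityʳ : ∀ xs → xs ⊗ [] ≡ xs
  ⊗-identityʳ xs = trans (⊗-comm xs []) (⊗-identityˡ xs)

  ⊗-exchange : ∀ xs ys zs → xs ⊗ ys ⊗ zs ≡ ys ⊗ xs ⊗ zs
  ⊗-exchange xs ys zs = trans (sym (⊗-assoc xs ys zs)) (trans (cong (_⊗ zs) (⊗-comm xs ys)) (⊗-assoc ys xs zs))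

  -- If g - h were nonzero, its leading coefficient times the leading 1 of w would survive in (g -
  -- h)·w = 0.
  ⊗-cancelˡ : ∀ w {g h} → w ⊗ g ≡ w ⊗ h → g ≡ h
  ⊗-cancelˡ w {g} {h} e with Poly-+ {⟦ g ⟧} { -ₛ ⟦ h ⟧} (⟦⟧-poly g) (Poly-neg {⟦ h ⟧} (⟦⟧-poly h))
  ... | d , udeg with top d (⟦ g ⟧ +ₛ -ₛ ⟦ h ⟧) udeg
  ...   | inj₁ z = ⟦⟧-injective λ i →
            trans (sym (⊕-⊖-cancel (⟦ g ⟧ i) (⟦ h ⟧ i))) (trans (cong (⟦ h ⟧ i ⊕_) (z i)) (+-identityʳ _))
  ...   | inj₂ (j , _ , nz , udeg′) = ⊥-elim (nz (begin
            u j                                 ≡⟨ *-identityʳ (u j) ⟨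
            u j ⊙ 𝟏                             ≡⟨ cong (u j ⊙_) (proj₁ (⟦⟧-monic w)) ⟨
            u j ⊙ ⟦ w ⟧ (length w)              ≡⟨ lead-* j (length w) u ⟦ w ⟧ udeg′ (proj₂ (⟦⟧-monic w)) ⟨
            (u *ₛ ⟦ w ⟧) (j + length w)         ≡⟨ vanish (j + length w) ⟩
            𝟎                                   ∎))
    where
    u : Series
    u = ⟦ g ⟧ +ₛ -ₛ ⟦ h ⟧
    products : ⟦ g ⟧ *ₛ ⟦ w ⟧ ≗ ⟦ h ⟧ *ₛ ⟦ w ⟧
    products i = begin
      (⟦ g ⟧ *ₛ ⟦ w ⟧) i  ≡⟨ ⟦⊗⟧ g w i ⟨
      ⟦ g ⊗ w ⟧ i         ≡⟨ cong (λ l → ⟦ l ⟧ i) (trans (⊗-comm g w) (trans e (⊗-comm w h))) ⟩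
      ⟦ h ⊗ w ⟧ i         ≡⟨ ⟦⊗⟧ h w i ⟩
      (⟦ h ⟧ *ₛ ⟦ w ⟧) i  ∎
    vanish : u *ₛ ⟦ w ⟧ ≗ 0ₛ
    vanish i = ⊕-cancelʳ ((⟦ h ⟧ *ₛ ⟦ w ⟧) i) _ _ (begin
      (u *ₛ ⟦ w ⟧) i ⊕ (⟦ h ⟧ *ₛ ⟦ w ⟧) i  ≡⟨ *ₛ-distribʳ ⟦ w ⟧ u ⟦ h ⟧ i ⟨
      ((u +ₛ ⟦ h ⟧) *ₛ ⟦ w ⟧) i            ≡⟨ *ₛ-congʳ ⟦ w ⟧ (λ j → trans (+-comm _ _) (⊕-⊖-cancel (⟦ g ⟧ j) (⟦ h ⟧ j))) i ⟩
      (⟦ g ⟧ *ₛ ⟦ w ⟧) i                   ≡⟨ products i ⟩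
      (⟦ h ⟧ *ₛ ⟦ w ⟧) i                   ≡⟨ +-identityˡ _ ⟨
      𝟎 ⊕ (⟦ h ⟧ *ₛ ⟦ w ⟧) i               ∎)

  words : ℕ → List (List K)
  words zero    = [] ∷ []
  words (suc d) = concatMap (λ x → map (x ∷_) (words d)) elements

  ∈-words⁺ : ∀ xs → xs ∈ words (length xs)
  ∈-words⁺ []       = here refl
  ∈-words⁺ (x ∷ xs) = ∈-concatMap⁺ (λ y → map (y ∷_) (words (length xs))) (lose (∈-elements x) (∈-map⁺ (x ∷_) (∈-words⁺ xs)))

  ∈-words⁻ : ∀ d {xs} → xs ∈ words d → length xs ≡ d
  ∈-words⁻ zero    (here refl) = refl
  ∈-words⁻ (suc d) p with find (∈-concatMap⁻ (λ y → map (y ∷_) (words d)) {xs = elements} p)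
  ... | x , _ , q with ∈-map⁻ (x ∷_) q
  ...   | ys , r , refl = cong suc (∈-words⁻ d r)

  ∑-words-suc : ∀ d (φ : List K → ℕ) → ∑ (words (suc d)) φ ≡ ∑[ x ∈ elements ] ∑[ xs ∈ words d ] φ (x ∷ xs)
  ∑-words-suc d φ = trans (∑-concatMap _ elements φ) (∑-cong elements (λ x → ∑-map (x ∷_) (words d) φ))

  ∑-words-δ : ∀ d ys (φ : List K → ℕ) → ∑[ xs ∈ words d ] (𝟙 (xs ≟ ys) * φ xs) ≡ 𝟙 (length ys ℕ.≟ d) * φ ys
  ∑-words-δ zero    []       φ = ℕ.+-identityʳ _
  ∑-words-δ zero    (y ∷ ys) φ = refl
  ∑-words-δ (suc d) []       φ = trans (∑-words-suc d _)
    (trans (∑-cong elements (λ x → ∑-zero (words d))) (∑-zero elements))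
  ∑-words-δ (suc d) (y ∷ ys) φ = begin
    ∑[ xs ∈ words (suc d) ] (𝟙 (xs ≟ (y ∷ ys)) * φ xs)
      ≡⟨ ∑-words-suc d _ ⟩
    ∑[ x ∈ elements ] ∑[ xs ∈ words d ] (𝟙 ((x ∷ xs) ≟ (y ∷ ys)) * φ (x ∷ xs))
      ≡⟨ ∑-cong elements (λ x → trans (∑-cong (words d) (λ xs →
           trans (cong (_* φ (x ∷ xs)) (𝟙-× ((x ∷ xs) ≟ (y ∷ ys)) (x ≟ᴷ y) (xs ≟ ys) ∷-injective (cong₂ _∷_)))
                 (ℕ.*-assoc (𝟙 (x ≟ᴷ y)) _ _)))
           (∑-*ˡ (words d) (𝟙 (x ≟ᴷ y)) _)) ⟩
    ∑[ x ∈ elements ] (𝟙 (x ≟ᴷ y) * ∑[ xs ∈ words d ] (𝟙 (xs ≟ ys) * φ (x ∷ xs)))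
      ≡⟨ enumerates y _ ⟩
    ∑[ xs ∈ words d ] (𝟙 (xs ≟ ys) * φ (y ∷ xs))
      ≡⟨ ∑-words-δ d ys (φ ∘ (y ∷_)) ⟩
    𝟙 (length ys ℕ.≟ d) * φ (y ∷ ys)
      ≡⟨ cong (_* φ (y ∷ ys)) (𝟙-cong (length ys ℕ.≟ d) (length (y ∷ ys) ℕ.≟ suc d) (cong suc) ℕ.suc-injective) ⟩
    𝟙 (length (y ∷ ys) ℕ.≟ suc d) * φ (y ∷ ys)
      ∎

  infix 4 _∣_ _∣?_
  _∣_ : List K → List K → Set
  w ∣ f = ∃[ h ] w ⊗ h ≡ f

  ∣-⊗ : ∀ w {f} g → w ∣ f → w ∣ g ⊗ f
  ∣-⊗ w g (h , e) = g ⊗ h , trans (⊗-exchange w g h) (cong (g ⊗_) e)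

  ∣⇒length≤ : ∀ w {f} → w ∣ f → length w ≤ length f
  ∣⇒length≤ w (h , e) = subst (length w ≤_) (trans (sym (length-⊗ w h)) (cong length e)) (ℕ.m≤m+n (length w) (length h))

  _∣?_ : ∀ w f → Dec (w ∣ f)
  w ∣? f = map′ (λ p → let h , _ , e = find p in h , e)
                (λ { (h , refl) → lose (subst (λ d → h ∈ words d) (cofactor-length h) (∈-words⁺ h)) refl })
                -- If w is longer than f, the truncated difference is 0 and the only candidate is
                -- the constant 1, which fails.
                (any? (λ h → (w ⊗ h) ≟ f) (words (length f ∸ length w)))
    where
    cofactor-length : ∀ h → length h ≡ length (w ⊗ h) ∸ length w
    cofactor-length h = sym (trans (cong (_∸ length w) (length-⊗ w h)) (ℕ.m+n∸m≡n (length w) (length h)))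

  ∣ₛ⇒∣ : ∀ {w f} → ⟦ w ⟧ ∣ₛ ⟦ f ⟧ → w ∣ f
  ∣ₛ⇒∣ {w} {f} (s , Ps , e) with monic-cofactor (⟦⟧-monic w) (⟦⟧-monic f) Ps e
  ... | j , ms , _ = prefix j s , ⟦⟧-injective λ i → begin
    ⟦ w ⊗ prefix j s ⟧ i              ≡⟨ ⟦⊗⟧ w (prefix j s) i ⟩
    (⟦ w ⟧ *ₛ ⟦ prefix j s ⟧) i       ≡⟨ *ₛ-comm ⟦ w ⟧ ⟦ prefix j s ⟧ i ⟩
    (⟦ prefix j s ⟧ *ₛ ⟦ w ⟧) i       ≡⟨ *ₛ-congʳ ⟦ w ⟧ (⟦prefix⟧ ms) i ⟩
    (s *ₛ ⟦ w ⟧) i                    ≡⟨ e i ⟩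
    ⟦ f ⟧ i                           ∎

  Reducible : List K → Set
  Reducible f = ∃[ g ] ∃[ h ] 1 ≤ length g × 1 ≤ length h × g ⊗ h ≡ f

  reducible? : ∀ f → Dec (Reducible f)
  reducible? f = map′ to from
    (ℕ.anyUpTo? (λ d → any? (λ g → (1 ≤? length g) ×-dec (g ∣? f)) (words d)) (length f))
    where
    to : (∃[ d ] d < length f × Any (λ g → 1 ≤ length g × g ∣ f) (words d)) → Reducible f
    to (d , d<f , p) with find p
    ... | g , g∈ , 1≤g , h , e = g , h , 1≤g , 1≤h , e
      where
      1≤h : 1 ≤ length h
      1≤h = ℕ.+-cancelˡ-≤ (length g) 1 (length h)
        (subst₂ _≤_ (trans (cong suc (sym (∈-words⁻ d g∈))) (ℕ.+-comm 1 (length g)))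
                    (trans (cong length (sym e)) (length-⊗ g h)) d<f)
    from : Reducible f → ∃[ d ] d < length f × Any (λ g → 1 ≤ length g × g ∣ f) (words d)
    from (g , h , 1≤g , 1≤h , refl) = length g ,
      subst₂ _≤_ (ℕ.+-comm (length g) 1) (sym (length-⊗ g h)) (ℕ.+-monoʳ-≤ (length g) 1≤h) ,
      lose (∈-words⁺ g) (1≤g , h , refl)

  Irreducible : List K → Set
  Irreducible p = 1 ≤ length p × ¬ Reducible p

  irreducible? : ∀ p → Dec (Irreducible p)
  irreducible? p = (1 ≤? length p) ×-dec ¬? (reducible? p)

  irreducible-factor : ∀ n f → length f ≤ n → 1 ≤ length f → ∃[ p ] ∃[ h ] Irreducible p × p ⊗ h ≡ f
  irreducible-factor zero    f f≤n 1≤f = ⊥-elim (ℕ.<⇒≱ 1≤f f≤n)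
  irreducible-factor (suc n) f f≤n 1≤f with reducible? f
  ... | no ¬r = f , [] , (1≤f , ¬r) , ⊗-identityʳ f
  ... | yes (g , h , 1≤g , 1≤h , refl) with irreducible-factor n g g≤n 1≤g
    where
    g≤n : length g ≤ n
    g≤n = ℕ.≤-pred (ℕ.≤-trans (subst (_≤ length g + length h) (ℕ.+-comm (length g) 1) (ℕ.+-monoʳ-≤ (length g) 1≤h))
                              (subst (_≤ suc n) (length-⊗ g h) f≤n))
  ...   | p , t , irr , refl = p , t ⊗ h , irr , sym (⊗-assoc p t h)

  -- Descent on the degree e of g: divide p by g and replace g by the normalised remainder.
  euclid-descent : ∀ {p} → Irreducible p → ∀ n e g h → e < n → Monic e g → e < length p → Poly h →
                   ⟦ p ⟧ ∣ₛ g *ₛ h → ⟦ p ⟧ ∣ₛ h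
  euclid-descent irr (suc n) zero    g h _ mg _ Ph d = ∣ₛ-resp (monic₀-identity h mg) d
  euclid-descent {p} irr@(_ , ¬red) (suc n) (suc e) g h (s≤s e<n) mg e<p Ph (t , Pt , te)
    with divMod mg _ ⟦ p ⟧ (proj₂ (⟦⟧-poly p))
  ... | s , r , Ps , rdeg , eq with top (suc e) r rdeg
  ...   | inj₁ z with monic-cofactor mg (⟦⟧-monic p) Ps
                       (λ i → sym (trans (eq i) (trans (cong ((s *ₛ g) i ⊕_) (z i)) (+-identityʳ _))))
  ...     | j , ms , j+e≡p = ⊥-elim (¬red (prefix j s , prefix (suc e) g , 1≤j , s≤s z≤n , ⟦⟧-injective λ i → begin
            ⟦ prefix j s ⊗ prefix (suc e) g ⟧ i           ≡⟨ ⟦⊗⟧ (prefix j s) (prefix (suc e) g) i ⟩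
            (⟦ prefix j s ⟧ *ₛ ⟦ prefix (suc e) g ⟧) i    ≡⟨ *ₛ-cong (⟦prefix⟧ ms) (⟦prefix⟧ mg) i ⟩
            (s *ₛ g) i                                    ≡⟨ +-identityʳ _ ⟨
            (s *ₛ g) i ⊕ 𝟎                                ≡⟨ cong ((s *ₛ g) i ⊕_) (z i) ⟨
            (s *ₛ g) i ⊕ r i                              ≡⟨ eq i ⟨
            ⟦ p ⟧ i                                       ∎))
      where
      1≤j : 1 ≤ length (prefix j s)
      1≤j = subst (1 ≤_) (sym (length-prefix j s))
              (ℕ.+-cancelʳ-≤ (suc e) 1 j (subst (suc (suc e) ≤_) (sym j+e≡p) e<p))
  euclid-descent {p} irr (suc n) (suc e) g h (s≤s e<n) mg e<p Ph (t , Pt , te)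
    | s , r , Ps , rdeg , eq | inj₂ (j , j<e , nz , rdeg′) =
    euclid-descent irr n j (c · r) h (ℕ.<-≤-trans j<e e<n) (normalise {f = r} nz rdeg′) (ℕ.<-trans j<e e<p) Ph
      (∣ₛ-resp (λ i → sym (·-*ₛ c r h i)) (∣ₛ-· {f = r *ₛ h} c
        (∣ₛ-difference {x = r *ₛ h} {s *ₛ t} {h} (Poly-* {s} {t} Ps Pt) Ph remainder)))
    where
    c = r j ⁻¹
    remainder : r *ₛ h +ₛ (s *ₛ t) *ₛ ⟦ p ⟧ ≗ h *ₛ ⟦ p ⟧
    remainder i = begin
      (r *ₛ h) i ⊕ ((s *ₛ t) *ₛ ⟦ p ⟧) i      ≡⟨ cong ((r *ₛ h) i ⊕_) (*ₛ-assoc s t ⟦ p ⟧ i) ⟩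
      (r *ₛ h) i ⊕ (s *ₛ (t *ₛ ⟦ p ⟧)) i      ≡⟨ cong ((r *ₛ h) i ⊕_) (*ₛ-congˡ s te i) ⟩
      (r *ₛ h) i ⊕ (s *ₛ (g *ₛ h)) i          ≡⟨ cong ((r *ₛ h) i ⊕_) (*ₛ-assoc s g h i) ⟨
      (r *ₛ h) i ⊕ ((s *ₛ g) *ₛ h) i          ≡⟨ +-comm _ _ ⟩
      ((s *ₛ g) *ₛ h) i ⊕ (r *ₛ h) i          ≡⟨ *ₛ-distribʳ h (s *ₛ g) r i ⟨
      ((s *ₛ g +ₛ r) *ₛ h) i                  ≡⟨ *ₛ-congʳ h eq i ⟨
      (⟦ p ⟧ *ₛ h) i                          ≡⟨ *ₛ-comm ⟦ p ⟧ h i ⟩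
      (h *ₛ ⟦ p ⟧) i                          ∎

  -- Reducing g modulo p either shows that p divides g, or leaves a nonzero remainder of smaller
  -- degree than p, to which the descent applies.
  euclid : ∀ {p} → Irreducible p → ∀ g h → p ∣ g ⊗ h → p ∣ g ⊎ p ∣ h
  euclid {[]}     (() , _)
  euclid {p@(x ∷ p′)} irr g h d with divMod (⟦⟧-monic p) _ ⟦ g ⟧ (proj₂ (⟦⟧-poly g))
  ... | s , r , Ps , rdeg , eq with top (length p) r rdeg
  ...   | inj₁ z = inj₁ (∣ₛ⇒∣ (s , Ps , λ i → sym (trans (eq i) (trans (cong ((s *ₛ ⟦ p ⟧) i ⊕_) (z i)) (+-identityʳ _)))))
  ...   | inj₂ (j , j<p , nz , rdeg′) = inj₂ (∣ₛ⇒∣ (euclid-descent irr (suc j) j (c · r) ⟦ h ⟧ ℕ.≤-refl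
            (normalise {f = r} nz rdeg′) j<p (⟦⟧-poly h) (∣ₛ-resp (λ i → sym (·-*ₛ c r ⟦ h ⟧ i)) (∣ₛ-· {f = r *ₛ ⟦ h ⟧} c
              (∣ₛ-difference {x = r *ₛ ⟦ h ⟧} {⟦ h ⟧ *ₛ s} {⟦ t ⟧} (Poly-* {⟦ h ⟧} {s} (⟦⟧-poly h) Ps) (⟦⟧-poly t) remainder)))))
    where
    c = r j ⁻¹
    t = proj₁ d
    remainder : r *ₛ ⟦ h ⟧ +ₛ (⟦ h ⟧ *ₛ s) *ₛ ⟦ p ⟧ ≗ ⟦ t ⟧ *ₛ ⟦ p ⟧
    remainder i = begin
      (r *ₛ ⟦ h ⟧) i ⊕ ((⟦ h ⟧ *ₛ s) *ₛ ⟦ p ⟧) i      ≡⟨ cong ((r *ₛ ⟦ h ⟧) i ⊕_) (*ₛ-assoc ⟦ h ⟧ s ⟦ p ⟧ i) ⟩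
      (r *ₛ ⟦ h ⟧) i ⊕ (⟦ h ⟧ *ₛ (s *ₛ ⟦ p ⟧)) i      ≡⟨ cong ((r *ₛ ⟦ h ⟧) i ⊕_) (*ₛ-comm ⟦ h ⟧ (s *ₛ ⟦ p ⟧) i) ⟩
      (r *ₛ ⟦ h ⟧) i ⊕ ((s *ₛ ⟦ p ⟧) *ₛ ⟦ h ⟧) i      ≡⟨ +-comm _ _ ⟩
      ((s *ₛ ⟦ p ⟧) *ₛ ⟦ h ⟧) i ⊕ (r *ₛ ⟦ h ⟧) i      ≡⟨ *ₛ-distribʳ ⟦ h ⟧ (s *ₛ ⟦ p ⟧) r i ⟨
      ((s *ₛ ⟦ p ⟧ +ₛ r) *ₛ ⟦ h ⟧) i                  ≡⟨ *ₛ-congʳ ⟦ h ⟧ eq i ⟨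
      (⟦ g ⟧ *ₛ ⟦ h ⟧) i                              ≡⟨ ⟦⊗⟧ g h i ⟨
      ⟦ g ⊗ h ⟧ i                                     ≡⟨ cong (λ l → ⟦ l ⟧ i) (proj₂ d) ⟨
      ⟦ p ⊗ t ⟧ i                                     ≡⟨ ⟦⊗⟧ p t i ⟩
      (⟦ p ⟧ *ₛ ⟦ t ⟧) i                              ≡⟨ *ₛ-comm ⟦ p ⟧ ⟦ t ⟧ i ⟩
      (⟦ t ⟧ *ₛ ⟦ p ⟧) i                              ∎

  pow : List K → ℕ → List K
  pow p zero    = []
  pow p (suc k) = p ⊗ pow p k

  length-pow : ∀ p k → length (pow p k) ≡ k * length p
  length-pow p zero    = refl
  length-pow p (suc k) = trans (length-⊗ p (pow p k)) (cong (length p +_) (length-pow p k))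

  -- By Euclid's lemma one factor r divides p or h. It cannot divide p, so it is cancelled from h
  -- and the rest follows by induction on k.
  pow-∣-coprime : ∀ {p r} → Irreducible p → Irreducible r → r ≢ p → ∀ k h → pow r k ∣ p ⊗ h → pow r k ∣ h
  pow-∣-coprime irrp irrr r≢p zero    h _ = h , ⊗-identityˡ h
  pow-∣-coprime {p} {r} irrp@(_ , ¬red) irrr r≢p (suc k) h (t , e)
    with euclid irrr p h (pow r k ⊗ t , trans (sym (⊗-assoc r (pow r k) t)) e)
  ... | inj₁ ([] , e′)    = ⊥-elim (r≢p (trans (sym (⊗-identityʳ r)) e′))
  ... | inj₁ (u ∷ us , e′) = ⊥-elim (¬red (r , u ∷ us , proj₁ irrr , s≤s z≤n , e′))
  ... | inj₂ (h′ , refl)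
    with pow-∣-coprime irrp irrr r≢p k h′ (t , ⊗-cancelˡ r (trans (sym (⊗-assoc r (pow r k) t)) (trans e (⊗-exchange p r h′))))
  ...   | (u , refl) = u , ⊗-assoc r (pow r k) u

  pow-∣-same : ∀ p k h → pow p (suc k) ∣ p ⊗ h → pow p k ∣ h
  pow-∣-same p k h (t , e) = t , ⊗-cancelˡ p (trans (sym (⊗-assoc p (pow p k) t)) e)

  pow-∣-suc : ∀ p k h → pow p k ∣ h → pow p (suc k) ∣ p ⊗ h
  pow-∣-suc p k h (t , e) = t , trans (⊗-assoc p (pow p k) t) (cong (p ⊗_) e)

  -- The exponent of r in f, written as a sum of divisibility indicators so that it can be regrouped
  -- over prime powers. The cutoff `n` has to be at least the degree of f.
  valuation : ℕ → List K → List K → ℕ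
  valuation n r f = ∑[ k ∈ upTo n ] 𝟙 (pow r (suc k) ∣? f)

  valuation-coprime : ∀ n {p r} → Irreducible p → Irreducible r → r ≢ p → ∀ h →
                      valuation n r (p ⊗ h) ≡ valuation n r h
  valuation-coprime n {p} {r} irrp irrr r≢p h = ∑-cong (upTo n) λ k →
    𝟙-cong (pow r (suc k) ∣? (p ⊗ h)) (pow r (suc k) ∣? h) (pow-∣-coprime irrp irrr r≢p (suc k) h) (∣-⊗ (pow r (suc k)) p)

  -- As p^(k+1) divides p·h exactly when p^k divides h, the two sums differ by an index shift. The
  -- gained term k = 0 is 1; the term k = n at the other end is 0, because p^n has larger degree
  -- than h.
  valuation-same : ∀ n {p} → Irreducible p → ∀ h → length (p ⊗ h) ≤ n →
                   valuation n p (p ⊗ h) ≡ valuation n p h + 1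
  valuation-same n {p} (1≤p , _) h ph≤n = begin
    valuation n p (p ⊗ h)
      ≡⟨ ∑-cong (upTo n) (λ k → 𝟙-cong (pow p (suc k) ∣? (p ⊗ h)) (pow p k ∣? h) (pow-∣-same p k h) (pow-∣-suc p k h)) ⟩
    ∑[ k ∈ upTo n ] 𝟙 (pow p k ∣? h)
      ≡⟨ ℕ.+-identityʳ _ ⟨
    ∑[ k ∈ upTo n ] 𝟙 (pow p k ∣? h) + 0
      ≡⟨ cong (∑[ k ∈ upTo n ] 𝟙 (pow p k ∣? h) +_) (𝟙-no (pow p n ∣? h) too-long) ⟨
    ∑[ k ∈ upTo n ] 𝟙 (pow p k ∣? h) + 𝟙 (pow p n ∣? h)
      ≡⟨ ∑-upTo-shift n (λ k → 𝟙 (pow p k ∣? h)) ⟩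
    𝟙 ([] ∣? h) + valuation n p h
      ≡⟨ cong (_+ valuation n p h) (𝟙-yes ([] ∣? h) (h , ⊗-identityˡ h)) ⟩
    1 + valuation n p h
      ≡⟨ ℕ.+-comm 1 _ ⟩
    valuation n p h + 1
      ∎
    where
    too-long : ¬ pow p n ∣ h
    too-long d = ℕ.<⇒≱ (ℕ.<-≤-trans (ℕ.m<n+m (length h) 1≤p) (subst (_≤ n) (length-⊗ p h) ph≤n))
      (ℕ.≤-trans (ℕ.m≤m*n n (length p) {{>-nonZero 1≤p}})
                 (subst (_≤ length h) (length-pow p n) (∣⇒length≤ (pow p n) d)))

  nonconstant : ℕ → List (List K)
  nonconstant n = concatMap (words ∘ suc) (upTo n)

  ∑-nonconstant-δ : ∀ n p (φ : List K → ℕ) → 1 ≤ length p → length p ≤ n →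
                    ∑[ r ∈ nonconstant n ] (𝟙 (r ≟ p) * φ r) ≡ φ p
  ∑-nonconstant-δ n p@(x ∷ p′) φ _ p≤n = begin
    ∑[ r ∈ nonconstant n ] (𝟙 (r ≟ p) * φ r)                         ≡⟨ ∑-concatMap (words ∘ suc) (upTo n) _ ⟩
    ∑[ d ∈ upTo n ] ∑[ r ∈ words (suc d) ] (𝟙 (r ≟ p) * φ r)         ≡⟨ ∑-cong (upTo n) (λ d → trans (∑-words-δ (suc d) p φ)
                                                                         (cong (_* φ p) (𝟙-cong (length p ℕ.≟ suc d) (d ℕ.≟ length p′)
                                                                           (sym ∘ ℕ.suc-injective) (cong suc ∘ sym)))) ⟩
    ∑[ d ∈ upTo n ] (𝟙 (d ℕ.≟ length p′) * φ p)                      ≡⟨ ∑-δ ℕ._≟_ (upTo n) (length p′) (λ _ → φ p) (upTo⁺ n) (∈-upTo⁺ p≤n) ⟩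
    φ p                                                              ∎

  weight : List K → ℕ
  weight r = 𝟙 (irreducible? r) * length r

  weighted-valuations : ℕ → List K → ℕ
  weighted-valuations n f = ∑[ r ∈ nonconstant n ] (weight r * valuation n r f)

  weighted-valuations-[] : ∀ n → weighted-valuations n [] ≡ 0
  weighted-valuations-[] n = trans (∑-cong (nonconstant n) vanish) (∑-zero (nonconstant n))
    where
    vanish : ∀ r → weight r * valuation n r [] ≡ 0
    vanish r with irreducible? r
    ... | no _          = refl
    ... | yes (1≤r , _) = trans (cong ((1 * length r) *_) (trans (∑-cong (upTo n) (λ k →
            𝟙-no (pow r (suc k) ∣? []) (λ d → ℕ.<⇒≱ (ℕ.≤-trans 1≤r (subst (length r ≤_) (sym (length-⊗ r (pow r k))) (ℕ.m≤m+n (length r) _)))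
                                                     (∣⇒length≤ (pow r (suc k)) d)))) (∑-zero (upTo n))))
            (ℕ.*-zeroʳ (1 * length r))

  -- Only the summand at `r ≡ p` changes, and it grows by the weight of `p`.
  weighted-valuations-⊗ : ∀ n {p} → Irreducible p → ∀ h → length (p ⊗ h) ≤ n →
                          weighted-valuations n (p ⊗ h) ≡ weighted-valuations n h + length p
  weighted-valuations-⊗ n {p} irr h ph≤n = begin
    ∑[ r ∈ nonconstant n ] (weight r * valuation n r (p ⊗ h))
      ≡⟨ ∑-cong (nonconstant n) step ⟩
    ∑[ r ∈ nonconstant n ] (weight r * valuation n r h + 𝟙 (r ≟ p) * weight r)
      ≡⟨ ∑-+ (nonconstant n) _ _ ⟩
    weighted-valuations n h + ∑[ r ∈ nonconstant n ] (𝟙 (r ≟ p) * weight r)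
      ≡⟨ cong (weighted-valuations n h +_) (∑-nonconstant-δ n p weight (proj₁ irr)
           (ℕ.≤-trans (subst (length p ≤_) (sym (length-⊗ p h)) (ℕ.m≤m+n _ _)) ph≤n)) ⟩
    weighted-valuations n h + weight p
      ≡⟨ cong (weighted-valuations n h +_) (trans (cong (_* length p) (𝟙-yes (irreducible? p) irr)) (ℕ.*-identityˡ _)) ⟩
    weighted-valuations n h + length p
      ∎
    where
    step : ∀ r → weight r * valuation n r (p ⊗ h) ≡ weight r * valuation n r h + 𝟙 (r ≟ p) * weight r
    step r with r ≟ p
    ... | yes refl = trans (cong (weight p *_) (valuation-same n irr h ph≤n))
                           (trans (ℕ.*-distribˡ-+ (weight p) (valuation n p h) 1)
                                  (cong (weight p * valuation n p h +_) (ℕ.*-comm (weight p) 1)))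
    ... | no r≢p with irreducible? r
    ...   | no _     = refl
    ...   | yes irrr = trans (cong ((1 * length r) *_) (valuation-coprime n irr irrr r≢p h)) (sym (ℕ.+-identityʳ _))

  -- Unique factorisation in additive form, by splitting off irreducible factors one at a time. `n`
  -- is the common cutoff of the sums, `m` bounds the recursion.
  weighted-valuations≡length : ∀ n m f → length f ≤ n → length f ≤ m → weighted-valuations n f ≡ length f
  weighted-valuations≡length n m       []        _   _   = weighted-valuations-[] n
  weighted-valuations≡length n (suc m) f@(_ ∷ _) f≤n f≤m with irreducible-factor (length f) f ℕ.≤-refl (s≤s z≤n)
  ... | p , h , irr , e = begin
    weighted-valuations n f                ≡⟨ cong (weighted-valuations n) e ⟨
    weighted-valuations n (p ⊗ h)          ≡⟨ weighted-valuations-⊗ n irr h (subst (λ l → length l ≤ n) (sym e) f≤n) ⟩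
    weighted-valuations n h + length p     ≡⟨ cong (_+ length p) (weighted-valuations≡length n m h
                                                (ℕ.≤-trans h≤f f≤n) (ℕ.≤-pred (ℕ.≤-trans h<f f≤m))) ⟩
    length h + length p                    ≡⟨ ℕ.+-comm (length h) _ ⟩
    length p + length h                    ≡⟨ length-⊗ p h ⟨
    length (p ⊗ h)                         ≡⟨ cong length e ⟩
    length f                               ∎
    where
    h<f : length h < length f
    h<f = subst (length h <_) (trans (sym (length-⊗ p h)) (cong length e)) (ℕ.m<n+m (length h) (proj₁ irr))
    h≤f : length h ≤ length f
    h≤f = ℕ.<⇒≤ h<f

  primePowers : ℕ → List (List K × ℕ)
  primePowers n = concatMap (λ r → map (r ,_) (upTo n)) (nonconstant n)

  power : List K × ℕ → List K
  power (r , k) = pow r (suc k)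

  -- This is the identity Λ * 1 = deg for the von Mangoldt function of polynomials.
  ∑-primePowers : ∀ n f → length f ≤ n → ∑[ x ∈ primePowers n ] (weight (proj₁ x) * 𝟙 (power x ∣? f)) ≡ length f
  ∑-primePowers n f f≤n = begin
    ∑[ x ∈ primePowers n ] (weight (proj₁ x) * 𝟙 (power x ∣? f))
      ≡⟨ ∑-concatMap _ (nonconstant n) _ ⟩
    ∑[ r ∈ nonconstant n ] ∑[ x ∈ map (r ,_) (upTo n) ] (weight (proj₁ x) * 𝟙 (power x ∣? f))
      ≡⟨ ∑-cong (nonconstant n) (λ r → trans (∑-map (r ,_) (upTo n) _) (∑-*ˡ (upTo n) (weight r) _)) ⟩
    weighted-valuations n f
      ≡⟨ weighted-valuations≡length n (length f) f f≤n ℕ.≤-refl ⟩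
    length f
      ∎

-- Classes of polynomials and the degree identity.

module Counting {K : Set} (𝔽 : FiniteFieldOn K) where
  open Data.Nat using (_*_)
  open ≡-Reasoning
  open MonicPolynomials 𝔽 public
  module Solver = RingSolver (fromCommutativeRing commutativeRing (λ _ → nothing))

  G : Set
  G = K × K

  infixl 6 _⊞_
  _⊞_ : G → G → G
  (a , b) ⊞ (a′ , b′) = a ⊕ a′ , b ⊕ b′

  nonzero? : ∀ x → Dec (x ≢ 𝟎)
  nonzero? x = ¬? (x ≟ᴷ 𝟎)

  ⊙-cancelʳ : ∀ {x y z} → x ≢ 𝟎 → y ⊙ x ≡ z ⊙ x → y ≡ z
  ⊙-cancelʳ {x} {y} {z} nz e = trans (unit y) (trans (cong (_⊙ x ⁻¹) e) (sym (unit z)))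
    where
    unit : ∀ y → y ≡ y ⊙ x ⊙ x ⁻¹
    unit y = sym (trans (*-assoc y x (x ⁻¹)) (trans (cong (y ⊙_) (⊙-inverseʳ x nz)) (*-identityʳ y)))

  ⊙-nonzero : ∀ {x y} → x ≢ 𝟎 → y ≢ 𝟎 → x ⊙ y ≢ 𝟎
  ⊙-nonzero {x} {y} x≢𝟎 y≢𝟎 e = x≢𝟎 (⊙-cancelʳ y≢𝟎 (trans e (sym (zeroˡ y))))

  -- The value 𝟎 in degree 0 gives the constant polynomial 1 the neutral class, as additivity
  -- requires.
  subleadingₛ : ℕ → Series → K
  subleadingₛ zero    f = 𝟎
  subleadingₛ (suc d) f = f d

  subleading : List K → K
  subleading xs = subleadingₛ (length xs) ⟦ xs ⟧

  subleadingₛ-* : ∀ m n {f g} → Monic m f → Monic n g →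
                  subleadingₛ (m + n) (f *ₛ g) ≡ subleadingₛ m f ⊕ subleadingₛ n g
  subleadingₛ-* zero zero mf mg = sym (+-identityˡ 𝟎)
  subleadingₛ-* zero (suc n) {f} {g} mf mg = trans (monic₀-identity g mf n) (sym (+-identityˡ (g n)))
  subleadingₛ-* (suc zero) zero {f} mf mg =
    trans (cong (f 0 ⊙_) (proj₁ mg)) (trans (*-identityʳ (f 0)) (sym (+-identityʳ (f 0))))
  subleadingₛ-* (suc zero) (suc n) {f} {g} mf mg =
    cong₂ _⊕_ (trans (cong (f 0 ⊙_) (proj₁ mg)) (*-identityʳ (f 0)))
              (monic₀-identity {f ∘ suc} g (proj₁ mf , Deg<-tail {f = f} (proj₂ mf)) n)
  subleadingₛ-* (suc (suc m)) n {f} {g} mf mg =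
    trans (cong₂ _⊕_ (trans (cong (f 0 ⊙_) (proj₂ mg (suc (m + n)) (s≤s (ℕ.m≤n+m n m)))) (zeroʳ (f 0)))
                     (subleadingₛ-* (suc m) n {f ∘ suc} {g} (proj₁ mf , Deg<-tail {f = f} (proj₂ mf)) mg))
          (+-identityˡ _)

  subleadingₛ-cong : ∀ d {f g} → f ≗ g → subleadingₛ d f ≡ subleadingₛ d g
  subleadingₛ-cong zero    e = refl
  subleadingₛ-cong (suc d) e = e d

  subleading-⊗ : ∀ g h → subleading (g ⊗ h) ≡ subleading g ⊕ subleading h
  subleading-⊗ g h = begin
    subleadingₛ (length (g ⊗ h)) ⟦ g ⊗ h ⟧                ≡⟨ cong (λ d → subleadingₛ d ⟦ g ⊗ h ⟧) (length-⊗ g h) ⟩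
    subleadingₛ (length g + length h) ⟦ g ⊗ h ⟧           ≡⟨ subleadingₛ-cong (length g + length h) (⟦⊗⟧ g h) ⟩
    subleadingₛ (length g + length h) (⟦ g ⟧ *ₛ ⟦ h ⟧)    ≡⟨ subleadingₛ-* (length g) (length h) (⟦⟧-monic g) (⟦⟧-monic h) ⟩
    subleading g ⊕ subleading h                           ∎

  -- This is c_{d-1}/c_d; being f′(0)/f(0), it is additive on products.
  logDerivative : List K → K
  logDerivative f = ⟦ f ⟧ 1 ⊙ ⟦ f ⟧ 0 ⁻¹

  logDerivative-⊗ : ∀ g h → ⟦ g ⟧ 0 ≢ 𝟎 → ⟦ h ⟧ 0 ≢ 𝟎 → logDerivative (g ⊗ h) ≡ logDerivative g ⊕ logDerivative h
  logDerivative-⊗ g h g₀≢𝟎 h₀≢𝟎 =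
    trans (cong₂ (λ x y → x ⊙ y ⁻¹) (⟦⊗⟧ g h 1) (⟦⊗⟧ g h 0)) (⊙-cancelʳ (⊙-nonzero g₀≢𝟎 h₀≢𝟎) (begin
      (g₀ ⊙ h₁ ⊕ g₁ ⊙ h₀) ⊙ (g₀ ⊙ h₀) ⁻¹ ⊙ (g₀ ⊙ h₀)
        ≡⟨ trans (*-assoc _ _ _) (cong ((g₀ ⊙ h₁ ⊕ g₁ ⊙ h₀) ⊙_) (trans (*-comm _ _) (⊙-inverseʳ _ (⊙-nonzero g₀≢𝟎 h₀≢𝟎)))) ⟩
      (g₀ ⊙ h₁ ⊕ g₁ ⊙ h₀) ⊙ 𝟏
        -- `𝟏` enters as a variable, so that each summand keeps its own copy, to be expanded as
        -- `g₀ ⊙ g₀ ⁻¹` in one and as `h₀ ⊙ h₀ ⁻¹` in the other.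
        ≡⟨ solve 5 (λ a b c d one → ((a :* b :+ c :* d) :* one) := (c :* d :* one :+ b :* a :* one)) refl g₀ h₁ g₁ h₀ 𝟏 ⟩
      g₁ ⊙ h₀ ⊙ 𝟏 ⊕ h₁ ⊙ g₀ ⊙ 𝟏
        ≡⟨ cong₂ (λ x y → g₁ ⊙ h₀ ⊙ x ⊕ h₁ ⊙ g₀ ⊙ y) (⊙-inverseʳ g₀ g₀≢𝟎) (⊙-inverseʳ h₀ h₀≢𝟎) ⟨
      g₁ ⊙ h₀ ⊙ (g₀ ⊙ g₀ ⁻¹) ⊕ h₁ ⊙ g₀ ⊙ (h₀ ⊙ h₀ ⁻¹)
        ≡⟨ solve 6 (λ a a′ b c c′ d → (b :* c :* (a :* a′) :+ d :* a :* (c :* c′)) := ((b :* a′ :+ d :* c′) :* (a :* c)))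
             refl g₀ (g₀ ⁻¹) g₁ h₀ (h₀ ⁻¹) h₁ ⟩
      (g₁ ⊙ g₀ ⁻¹ ⊕ h₁ ⊙ h₀ ⁻¹) ⊙ (g₀ ⊙ h₀)
        ∎))
    where
    open Solver using (solve) renaming (_⊕_ to _:+_; _⊗_ to _:*_; _⊜_ to _:=_)
    g₀ = ⟦ g ⟧ 0
    g₁ = ⟦ g ⟧ 1
    h₀ = ⟦ h ⟧ 0
    h₁ = ⟦ h ⟧ 1

  cls : List K → G
  cls f = subleading f , logDerivative f

  ν : List K → ℕ
  ν f = 𝟙 (nonzero? (⟦ f ⟧ 0))

  -- A product has nonzero constant term exactly when both factors do, and only then is
  -- `logDerivative` additive; `ν` discards the other cases.
  ν-cls-⊗ : ∀ g h (ψ : G → ℕ) → ν (g ⊗ h) * ψ (cls (g ⊗ h)) ≡ ν g * (ν h * ψ (cls g ⊞ cls h))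
  ν-cls-⊗ g h ψ with nonzero? (⟦ g ⟧ 0) | nonzero? (⟦ h ⟧ 0) | nonzero? (⟦ g ⊗ h ⟧ 0)
  ... | yes g₀ | yes h₀ | yes _ = trans (cong (λ u → 1 * ψ u) (cong₂ _,_ (subleading-⊗ g h) (logDerivative-⊗ g h g₀ h₀)))
                                        (sym (ℕ.*-identityˡ _))
  ... | yes g₀ | yes h₀ | no gh₀ = ⊥-elim (gh₀ (λ e → ⊙-nonzero g₀ h₀ (trans (sym (⟦⊗⟧ g h 0)) e)))
  ... | yes g₀ | no ¬h₀ | no _ = refl
  ... | no ¬g₀ | _      | no _ = refl
  ... | yes g₀ | no ¬h₀ | yes gh₀ = ⊥-elim (¬h₀ (λ e → gh₀ (trans (⟦⊗⟧ g h 0) (trans (cong (⟦ g ⟧ 0 ⊙_) e) (zeroʳ _)))))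
  ... | no ¬g₀ | _      | yes gh₀ = ⊥-elim (¬g₀ (λ e → gh₀ (trans (⟦⊗⟧ g h 0) (trans (cong (_⊙ ⟦ h ⟧ 0) e) (zeroˡ _)))))

  -- Cancellation makes the cofactor unique, so the sum has at most one nonzero term.
  ∣?-∑ : ∀ w f i → length f ≡ length w + i → 𝟙 (w ∣? f) ≡ ∑[ h ∈ words i ] 𝟙 (f ≟ (w ⊗ h))
  ∣?-∑ w f i len with w ∣? f
  ... | yes (h₀ , refl) = sym (begin
    ∑[ h ∈ words i ] 𝟙 ((w ⊗ h₀) ≟ (w ⊗ h))    ≡⟨ ∑-cong (words i) (λ h → trans (𝟙-cong ((w ⊗ h₀) ≟ (w ⊗ h)) (h ≟ h₀)
                                                  (sym ∘ ⊗-cancelˡ w) (cong (w ⊗_) ∘ sym)) (sym (ℕ.*-identityʳ _))) ⟩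
    ∑[ h ∈ words i ] (𝟙 (h ≟ h₀) * 1)          ≡⟨ ∑-words-δ i h₀ (λ _ → 1) ⟩
    𝟙 (length h₀ ℕ.≟ i) * 1                    ≡⟨ cong (_* 1) (𝟙-yes (length h₀ ℕ.≟ i) (ℕ.+-cancelˡ-≡ (length w) _ _
                                                    (trans (sym (length-⊗ w h₀)) len))) ⟩
    1                                          ∎)
  ... | no ¬d = sym (trans (∑-cong (words i) (λ h → 𝟙-no (f ≟ (w ⊗ h)) (λ e → ¬d (h , sym e)))) (∑-zero (words i)))

  ∑-multiples : ∀ w i (φ : List K → ℕ) →
                ∑[ f ∈ words (i + length w) ] (𝟙 (w ∣? f) * φ f) ≡ ∑[ h ∈ words i ] φ (w ⊗ h)
  ∑-multiples w i φ = begin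
    ∑[ f ∈ words m ] (𝟙 (w ∣? f) * φ f)
      ≡⟨ ∑-cong-∈ (words m) (λ f f∈ → trans
           (cong (_* φ f) (∣?-∑ w f i (trans (∈-words⁻ m f∈) (ℕ.+-comm i (length w)))))
           (sym (∑-*ʳ (words i) (φ f) _))) ⟩
    ∑[ f ∈ words m ] ∑[ h ∈ words i ] (𝟙 (f ≟ (w ⊗ h)) * φ f)
      ≡⟨ ∑-swap (words m) (words i) _ ⟩
    ∑[ h ∈ words i ] ∑[ f ∈ words m ] (𝟙 (f ≟ (w ⊗ h)) * φ f)
      ≡⟨ ∑-cong-∈ (words i) (λ h h∈ → trans (∑-words-δ m (w ⊗ h) φ)
           (trans (cong (_* φ (w ⊗ h)) (𝟙-yes (length (w ⊗ h) ℕ.≟ m)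
             (trans (length-⊗ w h) (trans (cong (length w +_) (∈-words⁻ i h∈)) (ℕ.+-comm (length w) i)))))
             (ℕ.*-identityˡ _))) ⟩
    ∑[ h ∈ words i ] φ (w ⊗ h)
      ∎
    where m = i + length w

  -- The cofactor degree is left to the diagonal sum, so that the sum over prime powers of all
  -- degrees can later be moved inside. Positive degree of `w` matches the first index of `diag`,
  -- which starts at 1.
  ∑-multiples-diag : ∀ w → 1 ≤ length w → ∀ m (φ : List K → ℕ) →
                     ∑[ f ∈ words m ] (𝟙 (w ∣? f) * φ f) ≡
                     diag (λ j i → 𝟙 (length w ℕ.≟ j) * ∑[ h ∈ words i ] φ (w ⊗ h)) m
  ∑-multiples-diag w@(x ∷ xs) _ m φ with length w ≤? m
  ... | yes w≤m = begin
    ∑[ f ∈ words m ] (𝟙 (w ∣? f) * φ f)                                      ≡⟨ cong (λ d → ∑[ f ∈ words d ] (𝟙 (w ∣? f) * φ f)) m≡ ⟩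
    ∑[ f ∈ words (i + length w) ] (𝟙 (w ∣? f) * φ f)                         ≡⟨ ∑-multiples w i φ ⟩
    ∑[ h ∈ words i ] φ (w ⊗ h)                                               ≡⟨ diag-δ-≤ i (length xs) c ⟨
    diag (λ j i → 𝟙 (length w ℕ.≟ j) * c i) (i + length w)                   ≡⟨ cong (diag _) m≡ ⟨
    diag (λ j i → 𝟙 (length w ℕ.≟ j) * c i) m                                ∎
    where
    i = m ∸ length w
    m≡ : m ≡ i + length w
    m≡ = sym (ℕ.m∸n+n≡m w≤m)
    c : ℕ → ℕ
    c i = ∑[ h ∈ words i ] φ (w ⊗ h)
  ... | no w≰m = trans
    (∑-cong-∈ (words m) (λ f f∈ → cong (_* φ f) (𝟙-no (w ∣? f)
      (λ d → w≰m (subst (length w ≤_) (∈-words⁻ m f∈) (∣⇒length≤ w d))))))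
    (trans (∑-zero (words m)) (sym (diag-δ-> m (length w) (λ i → ∑[ h ∈ words i ] φ (w ⊗ h)) (ℕ.≰⇒> w≰m))))

  -- `ψ` acts as a test function on classes; a character in its place would give the coefficient of
  -- t^m in the L-series.
  𝓜 : ℕ → (G → ℕ) → ℕ
  𝓜 m ψ = ∑[ h ∈ words m ] (ν h * ψ (cls h))

  module Bounded (n : ℕ) where

    -- The weights are the values of the von Mangoldt function. Meaningful only for j ≤ n,
    -- because primePowers n cuts off primes of degree and exponents greater than n.
    𝓝 : ℕ → (G → ℕ) → ℕ
    𝓝 j ψ = ∑[ x ∈ primePowers n ]
               (weight (proj₁ x) * (𝟙 (length (power x) ℕ.≟ j) * (ν (power x) * ψ (cls (power x)))))

    -- The degree m of f is replaced by the sum of the weights of the prime powers dividing it, the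
    -- sums are exchanged, and f is split into prime power and cofactor. For generating series this
    -- reads tL′ = (tL′/L)·L.
    degree-identity : ∀ m (ψ : G → ℕ) → m ≤ n →
                      m * 𝓜 m ψ ≡ diag (λ j i → 𝓝 j (λ u → 𝓜 i (λ v → ψ (u ⊞ v)))) m
    degree-identity m ψ m≤n = begin
      m * ∑ (words m) φ
        ≡⟨ ∑-*ˡ (words m) m φ ⟨
      ∑[ f ∈ words m ] (m * φ f)
        ≡⟨ ∑-cong-∈ (words m) (λ f f∈ → trans
             (cong (_* φ f) (sym (trans (∑-primePowers n f (subst (_≤ n) (sym (∈-words⁻ m f∈)) m≤n)) (∈-words⁻ m f∈))))
             (sym (∑-*ʳ (primePowers n) (φ f) _))) ⟩
      ∑[ f ∈ words m ] ∑[ x ∈ primePowers n ] (weight (proj₁ x) * 𝟙 (power x ∣? f) * φ f)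
        ≡⟨ ∑-swap (words m) (primePowers n) _ ⟩
      ∑[ x ∈ primePowers n ] ∑[ f ∈ words m ] (weight (proj₁ x) * 𝟙 (power x ∣? f) * φ f)
        ≡⟨ ∑-cong (primePowers n) (λ x → trans (∑-cong (words m) (λ f → ℕ.*-assoc (weight (proj₁ x)) _ _))
             (∑-*ˡ (words m) (weight (proj₁ x)) _)) ⟩
      ∑[ x ∈ primePowers n ] (weight (proj₁ x) * ∑[ f ∈ words m ] (𝟙 (power x ∣? f) * φ f))
        ≡⟨ ∑-cong (primePowers n) multiples ⟩
      ∑[ x ∈ primePowers n ] (weight (proj₁ x) *
        diag (λ j i → 𝟙 (length (power x) ℕ.≟ j) * ∑[ h ∈ words i ] φ (power x ⊗ h)) m)
        ≡⟨ ∑-diag (primePowers n) (weight ∘ proj₁) _ m ⟩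
      diag (λ j i → ∑[ x ∈ primePowers n ] (weight (proj₁ x) *
        (𝟙 (length (power x) ℕ.≟ j) * ∑[ h ∈ words i ] φ (power x ⊗ h)))) m
        ≡⟨ diag-cong m (λ j i → ∑-cong (primePowers n) (λ x →
             cong (λ s → weight (proj₁ x) * (𝟙 (length (power x) ℕ.≟ j) * s))
               (trans (∑-cong (words i) (λ h → ν-cls-⊗ (power x) h ψ)) (∑-*ˡ (words i) (ν (power x)) _)))) ⟩
      diag (λ j i → 𝓝 j (λ u → 𝓜 i (λ v → ψ (u ⊞ v)))) m
        ∎
      where
      φ : List K → ℕ
      φ f = ν f * ψ (cls f)
      multiples : ∀ x → weight (proj₁ x) * ∑[ f ∈ words m ] (𝟙 (power x ∣? f) * φ f) ≡
                        weight (proj₁ x) * diag (λ j i → 𝟙 (length (power x) ℕ.≟ j) * ∑[ h ∈ words i ] φ (power x ⊗ h)) m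
      multiples x@(r , k) with irreducible? r
      ... | no _          = refl
      ... | yes (1≤r , _) = cong ((1 * length r) *_) (∑-multiples-diag (power x)
              (ℕ.≤-trans 1≤r (subst (length r ≤_) (sym (length-⊗ r (pow r k))) (ℕ.m≤m+n (length r) _))) m φ)

-- Distribution of classes in each degree, and the convolution operator.

module ClassSums {K : Set} (𝔽 : FiniteFieldOn K) where
  open Data.Nat using (_*_)
  open ≡-Reasoning
  open Counting 𝔽 public
  open RingProperties (CommutativeRing.ring commutativeRing) using (-‿distribˡ-*; -‿distribʳ-*; -‿involutive)

  q : ℕ
  q = length elements

  S : (K → ℕ) → ℕ
  S = ∑ elements

  μ : K → ℕ
  μ x = 𝟙 (nonzero? x)

  S* : (K → ℕ) → ℕ
  S* ρ = S (λ c → μ c * ρ c)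

  κ : ℕ
  κ = S μ

  S₂ : (G → ℕ) → ℕ
  S₂ ψ = S (λ a → S (λ b → ψ (a , b)))

  S*-cong : ∀ {ρ σ} → (∀ c → c ≢ 𝟎 → ρ c ≡ σ c) → S* ρ ≡ S* σ
  S*-cong e = ∑-cong elements (λ c → 𝟙-subst (nonzero? c) (e c))

  S*-const : ∀ m → S* (λ _ → m) ≡ κ * m
  S*-const m = ∑-*ʳ elements m μ

  S₂-swap : ∀ ψ → S (λ b → S (λ a → ψ (a , b))) ≡ S₂ ψ
  S₂-swap ψ = ∑-swap elements elements _

  S*+𝟎 : ∀ ρ → S* ρ + ρ 𝟎 ≡ S ρ
  S*+𝟎 ρ = begin
    S* ρ + ρ 𝟎                                           ≡⟨ cong (S* ρ +_) (enumerates 𝟎 ρ) ⟨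
    S* ρ + ∑[ x ∈ elements ] (𝟙 (x ≟ᴷ 𝟎) * ρ x)          ≡⟨ ∑-+ elements _ _ ⟨
    ∑[ x ∈ elements ] (μ x * ρ x + 𝟙 (x ≟ᴷ 𝟎) * ρ x)     ≡⟨ ∑-cong elements (λ x → trans (sym (ℕ.*-distribʳ-+ (ρ x) (μ x) _))
                                                             (trans (cong (_* ρ x) (trans (ℕ.+-comm (μ x) _) (𝟙-complement (x ≟ᴷ 𝟎))))
                                                                    (ℕ.*-identityˡ (ρ x)))) ⟩
    S ρ                                                  ∎

  κ+1 : κ + 1 ≡ q
  κ+1 = trans (cong (_+ 1) (sym (trans (S*-const 1) (ℕ.*-identityʳ κ))))
              (trans (S*+𝟎 (λ _ → 1)) (trans (∑-const elements 1) (ℕ.*-identityʳ q)))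

  term≤S : ∀ ρ a → ρ a ≤ S ρ
  term≤S ρ a = subst (_≤ S ρ) (enumerates a ρ) (∑-mono elements (λ x → bound (x ≟ᴷ a) (ρ x)))
    where
    bound : ∀ {P : Set} (d : Dec P) m → 𝟙 d * m ≤ m
    bound (yes _) m = ℕ.≤-reflexive (ℕ.*-identityˡ m)
    bound (no _)  m = z≤n

  1≤κ : 1 ≤ κ
  1≤κ = subst (_≤ κ) (𝟙-yes (nonzero? 𝟏) 𝟏≢𝟎) (term≤S μ 𝟏)

  ⊖-⊕-cancel : ∀ u x → ⊖ u ⊕ (u ⊕ x) ≡ x
  ⊖-⊕-cancel u x = trans (sym (+-assoc _ _ _)) (trans (cong (_⊕ x) (-‿inverseˡ u)) (+-identityˡ x))

  ⊕-⊖-cancelˡ : ∀ u x → u ⊕ (⊖ u ⊕ x) ≡ x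
  ⊕-⊖-cancelˡ u x = trans (sym (+-assoc _ _ _)) (trans (cong (_⊕ x) (-‿inverseʳ u)) (+-identityˡ x))

  S-shift : ∀ u ρ → S (λ x → ρ (u ⊕ x)) ≡ S ρ
  S-shift u ρ = ∑-reindex _≟ᴷ_ {elements} enumerates (u ⊕_) (⊖ u ⊕_) (⊖-⊕-cancel u) (⊕-⊖-cancelˡ u) ρ

  S₂-shift : ∀ u ψ → S₂ (λ v → ψ (u ⊞ v)) ≡ S₂ ψ
  S₂-shift (a , b) ψ = trans (∑-cong elements (λ x → S-shift b (λ y → ψ (a ⊕ x , y))))
                             (S-shift a (λ x → S (λ y → ψ (x , y))))

  ⁻¹-nonzero : ∀ {x} → x ≢ 𝟎 → x ⁻¹ ≢ 𝟎
  ⁻¹-nonzero {x} nz e = 𝟏≢𝟎 (trans (sym (⊙-inverseʳ x nz)) (trans (cong (x ⊙_) e) (zeroʳ x)))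

  ⁻¹-unique : ∀ {x y} → x ≢ 𝟎 → y ⊙ x ≡ 𝟏 → x ⁻¹ ≡ y
  ⁻¹-unique {x} nz e = ⊙-cancelʳ nz (trans (*-comm _ _) (trans (⊙-inverseʳ x nz) (sym e)))

  ⁻¹-involutive : ∀ x → x ⁻¹ ⁻¹ ≡ x
  ⁻¹-involutive x with x ≟ᴷ 𝟎
  ... | yes refl = trans (cong _⁻¹ 𝟎⁻¹≡𝟎) 𝟎⁻¹≡𝟎
  ... | no nz    = ⁻¹-unique (⁻¹-nonzero nz) (⊙-inverseʳ x nz)

  S*-reindex : ∀ (φ φ⁻¹ : K → K) → (∀ x → φ⁻¹ (φ x) ≡ x) → (∀ x → φ (φ⁻¹ x) ≡ x) →
               φ 𝟎 ≡ 𝟎 → ∀ ρ → S* (ρ ∘ φ) ≡ S* ρ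
  S*-reindex φ φ⁻¹ invˡ invʳ φ𝟎 ρ = trans
    (∑-cong elements (λ x → cong (_* ρ (φ x)) (𝟙-cong (nonzero? x) (nonzero? (φ x))
      (λ nz e → nz (trans (sym (invˡ x)) (trans (cong φ⁻¹ (trans e (sym φ𝟎))) (invˡ 𝟎))))
      (λ nz e → nz (trans (cong φ e) φ𝟎)))))
    (∑-reindex _≟ᴷ_ {elements} enumerates φ φ⁻¹ invˡ invʳ (λ x → μ x * ρ x))

  S*-⁻¹ : ∀ ρ → S* (ρ ∘ _⁻¹) ≡ S* ρ
  S*-⁻¹ = S*-reindex _⁻¹ _⁻¹ ⁻¹-involutive ⁻¹-involutive 𝟎⁻¹≡𝟎

  ⊙-⁻¹-cancel : ∀ {y} → y ≢ 𝟎 → ∀ x → y ⊙ (y ⁻¹ ⊙ x) ≡ x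
  ⊙-⁻¹-cancel {y} nz x = trans (sym (*-assoc _ _ _)) (trans (cong (_⊙ x) (⊙-inverseʳ y nz)) (*-identityˡ x))

  ⁻¹-⊙-cancel : ∀ {y} → y ≢ 𝟎 → ∀ x → y ⁻¹ ⊙ (y ⊙ x) ≡ x
  ⁻¹-⊙-cancel {y} nz x =
    trans (sym (*-assoc _ _ _)) (trans (cong (_⊙ x) (trans (*-comm _ _) (⊙-inverseʳ y nz))) (*-identityˡ x))

  S*-quotient : ∀ {y} → y ≢ 𝟎 → ∀ ρ → S* (λ x → ρ (y ⊙ x ⁻¹)) ≡ S* ρ
  S*-quotient {y} nz ρ = trans (S*-⁻¹ (λ x → ρ (y ⊙ x)))
    (S*-reindex (y ⊙_) (y ⁻¹ ⊙_) (⁻¹-⊙-cancel nz) (⊙-⁻¹-cancel nz) (zeroʳ y) ρ)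

  S-scale : ∀ {x} → x ≢ 𝟎 → ∀ ρ → S (λ y → ρ (y ⊙ x ⁻¹)) ≡ S ρ
  S-scale {x} nz ρ = ∑-reindex _≟ᴷ_ {elements} enumerates (_⊙ x ⁻¹) (_⊙ x)
    (λ y → trans (*-comm _ _) (trans (cong (x ⊙_) (*-comm _ _)) (⊙-⁻¹-cancel nz y)))
    (λ y → trans (*-comm _ _) (trans (cong (x ⁻¹ ⊙_) (*-comm _ _)) (⁻¹-⊙-cancel nz y))) ρ

  𝓜-cong : ∀ m {ψ φ} → (∀ u → ψ u ≡ φ u) → 𝓜 m ψ ≡ 𝓜 m φ
  𝓜-cong m e = ∑-cong (words m) (λ h → cong (ν h *_) (e (cls h)))

  𝓜-0 : ∀ ψ → 𝓜 0 ψ ≡ ψ (𝟎 , 𝟎)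
  𝓜-0 ψ = trans (ℕ.+-identityʳ _) (trans (cong₂ _*_ (𝟙-yes (nonzero? 𝟏) 𝟏≢𝟎) (cong (λ b → ψ (𝟎 , b)) (zeroˡ _)))
                                         (ℕ.*-identityˡ _))

  𝓜-1 : ∀ ψ → 𝓜 1 ψ ≡ S* (λ c → ψ (c , c ⁻¹))
  𝓜-1 ψ = trans (∑-words-suc 0 _) (∑-cong elements (λ c →
    trans (ℕ.+-identityʳ _) (cong (λ b → μ c * ψ (c , b)) (*-identityˡ _))))

  -- X² + yX + x has class (y , y/x). Both coordinates involve y, which is why the classes are not
  -- yet equidistributed in degree 2.
  𝓜-2 : ∀ ψ → 𝓜 2 ψ ≡ S* (λ x → S (λ y → ψ (y , y ⊙ x ⁻¹)))
  𝓜-2 ψ = trans (∑-words-suc 1 _) (∑-cong elements (λ x →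
    trans (∑-words-suc 0 _) (trans (∑-cong elements (λ y → ℕ.+-identityʳ _)) (∑-*ˡ elements (μ x) _))))

  subleading-uniform : ∀ k (ρ : K → ℕ) → ∑[ xs ∈ words (suc k) ] ρ (subleading xs) ≡ q ^ k * S ρ
  subleading-uniform zero    ρ = trans (∑-words-suc 0 _) (trans (∑-cong elements (λ x → ℕ.+-identityʳ _)) (sym (ℕ.*-identityˡ _)))
  subleading-uniform (suc k) ρ = begin
    ∑[ xs ∈ words (2 + k) ] ρ (subleading xs)
      ≡⟨ ∑-words-suc (suc k) _ ⟩
    S (λ x → ∑[ xs ∈ words (suc k) ] ρ (subleading (x ∷ xs)))
      ≡⟨ ∑-cong elements (λ x → trans (∑-words-suc k _) (sym (∑-words-suc k _))) ⟩
    S (λ x → ∑[ xs ∈ words (suc k) ] ρ (subleading xs))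
      ≡⟨ ∑-cong elements (λ x → subleading-uniform k ρ) ⟩
    S (λ x → q ^ k * S ρ)
      ≡⟨ ∑-const elements _ ⟩
    q * (q ^ k * S ρ)
      ≡⟨ ℕ.*-assoc q _ _ ⟨
    q * q ^ k * S ρ
      ∎

  -- From degree 3 on, the first, next-to-last and last coefficients are three different ones, and
  -- dividing by a fixed nonzero last coefficient permutes K.
  𝓜-3+ : ∀ k ψ → 𝓜 (3 + k) ψ ≡ κ * (q ^ k * S₂ ψ)
  𝓜-3+ k ψ = begin
    𝓜 (3 + k) ψ
      ≡⟨ trans (∑-words-suc (2 + k) _) (∑-cong elements (λ x → trans (∑-words-suc (suc k) _) (∑-cong elements (λ y →
           trans (∑-words-suc k _) (sym (∑-words-suc k _)))))) ⟩
    S (λ x → S (λ y → ∑[ xs ∈ words (suc k) ] (μ x * ψ (subleading xs , y ⊙ x ⁻¹))))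
      ≡⟨ ∑-cong elements (λ x → trans (∑-cong elements (λ y → ∑-*ˡ (words (suc k)) (μ x) _)) (∑-*ˡ elements (μ x) _)) ⟩
    S* (λ x → S (λ y → ∑[ xs ∈ words (suc k) ] ψ (subleading xs , y ⊙ x ⁻¹)))
      ≡⟨ S*-cong (λ x _ → trans (∑-cong elements (λ y → subleading-uniform k (λ a → ψ (a , y ⊙ x ⁻¹)))) (∑-*ˡ elements (q ^ k) _)) ⟩
    S* (λ x → q ^ k * S (λ y → S (λ a → ψ (a , y ⊙ x ⁻¹))))
      ≡⟨ S*-cong (λ x nz → cong (q ^ k *_) (trans (S-scale nz (λ b → S (λ a → ψ (a , b)))) (S₂-swap ψ))) ⟩
    S* (λ x → q ^ k * S₂ ψ)
      ≡⟨ S*-const _ ⟩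
    κ * (q ^ k * S₂ ψ)
      ∎

  -- A single coordinate is equidistributed already in degree 2, where the pair is not.
  𝓜-2+-subleading : ∀ k ρ → 𝓜 (2 + k) (ρ ∘ proj₁) ≡ κ * (q ^ k * S ρ)
  𝓜-2+-subleading zero    ρ = trans (𝓜-2 (ρ ∘ proj₁)) (trans (S*-const (S ρ)) (cong (κ *_) (sym (ℕ.*-identityˡ _))))
  𝓜-2+-subleading (suc k) ρ = trans (𝓜-3+ k _) (cong (κ *_)
    (trans (cong (q ^ k *_) (trans (∑-cong elements (λ a → ∑-const elements (ρ a))) (∑-*ˡ elements q ρ)))
           (trans (sym (ℕ.*-assoc (q ^ k) q _)) (cong (_* S ρ) (ℕ.*-comm (q ^ k) q)))))

  𝓜-2+-logDerivative : ∀ k ρ → 𝓜 (2 + k) (ρ ∘ proj₂) ≡ κ * (q ^ k * S ρ)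
  𝓜-2+-logDerivative zero    ρ =
    trans (𝓜-2 (ρ ∘ proj₂)) (trans (S*-cong (λ x nz → S-scale nz ρ)) (trans (S*-const (S ρ)) (cong (κ *_) (sym (ℕ.*-identityˡ _)))))
  𝓜-2+-logDerivative (suc k) ρ = trans (𝓜-3+ k _) (cong (κ *_)
    (trans (cong (q ^ k *_) (∑-const elements (S ρ)))
           (trans (sym (ℕ.*-assoc (q ^ k) q _)) (cong (_* S ρ) (ℕ.*-comm (q ^ k) q)))))

  𝓜-1+-total : ∀ k → 𝓜 (1 + k) (λ _ → 1) ≡ κ * q ^ k
  𝓜-1+-total zero    = trans (𝓜-1 _) (S*-const 1)
  𝓜-1+-total (suc k) = trans (𝓜-2+-subleading k (λ _ → 1)) (cong (κ *_)
    (trans (cong (q ^ k *_) (trans (∑-const elements 1) (ℕ.*-identityʳ q))) (ℕ.*-comm (q ^ k) q)))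

  row column : (G → ℕ) → K → ℕ
  row    ψ a = S (λ b → ψ (a , b))
  column ψ b = S (λ a → ψ (a , b))

  -- For y ≠ 0 the quotient y/x takes every nonzero value once and misses only (y , 0); for y = 0
  -- all κ polynomials have class (0 , 0). Thus degree 2 is uniform off the axes, with κ extra at
  -- the origin. Adding both axes counts the origin twice, which turns κ into q.
  𝓜-2-axes : ∀ ψ → 𝓜 2 ψ + (row ψ 𝟎 + column ψ 𝟎) ≡ S₂ ψ + q * ψ (𝟎 , 𝟎)
  𝓜-2-axes ψ = begin
    𝓜 2 ψ + (row ψ 𝟎 + column ψ 𝟎)
      ≡⟨ cong₂ (λ s t → s + (t + column ψ 𝟎)) regroup (sym (enumerates 𝟎 (λ _ → row ψ 𝟎))) ⟩
    S H + (S (λ y → 𝟙 (y ≟ᴷ 𝟎) * row ψ 𝟎) + column ψ 𝟎)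
      ≡⟨ cong (S H +_) (∑-+ elements _ _) ⟨
    S H + S (λ y → 𝟙 (y ≟ᴷ 𝟎) * row ψ 𝟎 + ψ (y , 𝟎))
      ≡⟨ ∑-+ elements _ _ ⟨
    S (λ y → H y + (𝟙 (y ≟ᴷ 𝟎) * row ψ 𝟎 + ψ (y , 𝟎)))
      ≡⟨ ∑-cong elements pointwise ⟩
    S (λ y → row ψ y + 𝟙 (y ≟ᴷ 𝟎) * (q * ψ (𝟎 , 𝟎)))
      ≡⟨ ∑-+ elements _ _ ⟩
    S₂ ψ + S (λ y → 𝟙 (y ≟ᴷ 𝟎) * (q * ψ (𝟎 , 𝟎)))
      ≡⟨ cong (S₂ ψ +_) (enumerates 𝟎 (λ _ → q * ψ (𝟎 , 𝟎))) ⟩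
    S₂ ψ + q * ψ (𝟎 , 𝟎)
      ∎
    where
    H : K → ℕ
    H y = S* (λ x → ψ (y , y ⊙ x ⁻¹))
    regroup : 𝓜 2 ψ ≡ S H
    regroup = trans (𝓜-2 ψ) (trans (∑-cong elements (λ x → sym (∑-*ˡ elements (μ x) _))) (∑-swap elements elements _))
    arrange : ∀ k s f → k * f + (1 * s + f) ≡ s + 1 * ((k + 1) * f)
    arrange = solve-∀
    pointwise : ∀ y → H y + (𝟙 (y ≟ᴷ 𝟎) * row ψ 𝟎 + ψ (y , 𝟎)) ≡ row ψ y + 𝟙 (y ≟ᴷ 𝟎) * (q * ψ (𝟎 , 𝟎))
    pointwise y with y ≟ᴷ 𝟎
    ... | yes refl = trans (cong (_+ (1 * row ψ 𝟎 + ψ (𝟎 , 𝟎)))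
                             (trans (S*-cong (λ x _ → cong (λ b → ψ (𝟎 , b)) (zeroˡ _))) (S*-const _)))
                           (trans (arrange κ (row ψ 𝟎) (ψ (𝟎 , 𝟎))) (cong (λ m → row ψ 𝟎 + 1 * (m * ψ (𝟎 , 𝟎))) κ+1))
    ... | no nz    = trans (cong (_+ ψ (y , 𝟎)) (S*-quotient nz (λ b → ψ (y , b))))
                           (trans (S*+𝟎 (λ b → ψ (y , b))) (sym (ℕ.+-identityʳ _)))

  -- Convolution with the set of points (c , c⁻¹), the classes of the monic linear polynomials.
  A : (G → ℕ) → G → ℕ
  A ψ u = S* (λ c → ψ (u ⊞ (c , c ⁻¹)))

  S₂-A : ∀ ψ → S₂ (A ψ) ≡ κ * S₂ ψ
  S₂-A ψ = begin
    S (λ a → S (λ b → S (λ c → μ c * ψ (a ⊕ c , b ⊕ c ⁻¹))))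
      ≡⟨ ∑-cong elements (λ a → ∑-swap elements elements _) ⟩
    S (λ a → S (λ c → S (λ b → μ c * ψ (a ⊕ c , b ⊕ c ⁻¹))))
      ≡⟨ ∑-swap elements elements _ ⟩
    S (λ c → S (λ a → S (λ b → μ c * ψ (a ⊕ c , b ⊕ c ⁻¹))))
      ≡⟨ ∑-cong elements (λ c → trans (∑-cong elements (λ a → ∑-*ˡ elements (μ c) _)) (∑-*ˡ elements (μ c) _)) ⟩
    S* (λ c → S₂ (λ u → ψ (u ⊞ (c , c ⁻¹))))
      ≡⟨ S*-cong (λ c _ → trans (∑-cong elements (λ a → ∑-cong elements (λ b →
           cong₂ (λ x y → ψ (x , y)) (+-comm a c) (+-comm b (c ⁻¹))))) (S₂-shift (c , c ⁻¹) ψ)) ⟩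
    S* (λ c → S₂ ψ)
      ≡⟨ S*-const _ ⟩
    κ * S₂ ψ
      ∎

  -- Row 0 of `A ψ` collects the rows c ≠ 0 of `ψ`, so that only row 0 is missing from the full sum.
  row-A : ∀ ψ → row (A ψ) 𝟎 + row ψ 𝟎 ≡ S₂ ψ
  row-A ψ = trans (cong (_+ row ψ 𝟎) (begin
    S (λ b → S* (λ c → ψ (𝟎 ⊕ c , b ⊕ c ⁻¹)))
      ≡⟨ ∑-swap elements elements _ ⟩
    S (λ c → S (λ b → μ c * ψ (𝟎 ⊕ c , b ⊕ c ⁻¹)))
      ≡⟨ ∑-cong elements (λ c → trans (∑-*ˡ elements (μ c) _) (cong (μ c *_) (trans
           (∑-cong elements (λ b → cong₂ (λ x y → ψ (x , y)) (+-identityˡ c) (+-comm b (c ⁻¹)))) (S-shift (c ⁻¹) (λ b → ψ (c , b)))))) ⟩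
    S* (row ψ)
      ∎)) (S*+𝟎 (row ψ))

  column-A : ∀ ψ → column (A ψ) 𝟎 + column ψ 𝟎 ≡ S₂ ψ
  column-A ψ = trans (cong (_+ column ψ 𝟎) (begin
    S (λ a → S* (λ c → ψ (a ⊕ c , 𝟎 ⊕ c ⁻¹)))
      ≡⟨ ∑-swap elements elements _ ⟩
    S (λ c → S (λ a → μ c * ψ (a ⊕ c , 𝟎 ⊕ c ⁻¹)))
      ≡⟨ ∑-cong elements (λ c → trans (∑-*ˡ elements (μ c) _) (cong (μ c *_) (trans
           (∑-cong elements (λ a → cong₂ (λ x y → ψ (x , y)) (+-comm a c) (+-identityˡ (c ⁻¹)))) (S-shift c (λ a → ψ (a , c ⁻¹)))))) ⟩
    S* (column ψ ∘ _⁻¹)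
      ≡⟨ S*-⁻¹ (column ψ) ⟩
    S* (column ψ)
      ∎)) (trans (S*+𝟎 (column ψ)) (S₂-swap ψ))

  ⊖-nonzero : ∀ {c} → c ≢ 𝟎 → ⊖ c ≢ 𝟎
  ⊖-nonzero {c} nz e = nz (trans (sym (-‿involutive c)) (trans (cong ⊖_ e) ⊖𝟎≡𝟎))

  ⊖-⁻¹ : ∀ {c} → c ≢ 𝟎 → (⊖ c) ⁻¹ ≡ ⊖ (c ⁻¹)
  ⊖-⁻¹ {c} nz = ⁻¹-unique (⊖-nonzero nz) (begin
    ⊖ (c ⁻¹) ⊙ ⊖ c        ≡⟨ -‿distribˡ-* (c ⁻¹) (⊖ c) ⟨
    ⊖ (c ⁻¹ ⊙ ⊖ c)        ≡⟨ cong ⊖_ (-‿distribʳ-* (c ⁻¹) c) ⟨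
    ⊖ ⊖ (c ⁻¹ ⊙ c)        ≡⟨ -‿involutive _ ⟩
    c ⁻¹ ⊙ c              ≡⟨ *-comm _ _ ⟩
    c ⊙ c ⁻¹              ≡⟨ ⊙-inverseʳ c nz ⟩
    𝟏                     ∎)

  ⊕-⊖-cancelʳ : ∀ x c → x ⊕ c ⊕ ⊖ c ≡ x
  ⊕-⊖-cancelʳ x c = trans (+-assoc x c _) (trans (cong (x ⊕_) (-‿inverseʳ c)) (+-identityʳ x))

  -- Only the terms d = -c of the double sum over c and d are kept.
  A-A : ∀ ψ u → κ * ψ u ≤ A (A ψ) u
  A-A ψ u = subst (_≤ A (A ψ) u) (S*-const (ψ u)) (∑-mono elements bound)
    where
    bound : ∀ c → μ c * ψ u ≤ μ c * A ψ (u ⊞ (c , c ⁻¹))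
    bound c with nonzero? c
    ... | no _   = z≤n
    ... | yes nz = ℕ.*-monoʳ-≤ 1 (subst (_≤ A ψ (u ⊞ (c , c ⁻¹))) opposite
                     (term≤S (λ d → μ d * ψ (u ⊞ (c , c ⁻¹) ⊞ (d , d ⁻¹))) (⊖ c)))
      where
      opposite : μ (⊖ c) * ψ (u ⊞ (c , c ⁻¹) ⊞ (⊖ c , (⊖ c) ⁻¹)) ≡ ψ u
      opposite = trans (cong₂ _*_ (𝟙-yes (nonzero? (⊖ c)) (⊖-nonzero nz))
        (cong ψ (cong₂ _,_ (⊕-⊖-cancelʳ _ c) (trans (cong (proj₂ u ⊕ c ⁻¹ ⊕_) (⊖-⁻¹ nz)) (⊕-⊖-cancelʳ _ (c ⁻¹))))))
        (ℕ.*-identityˡ _)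

-- The recurrence for weighted prime power counts, and the lower bound.

module Recurrence {K : Set} (𝔽 : FiniteFieldOn K) (n : ℕ) where
  open Data.Nat using (_*_)
  open ≡-Reasoning
  open ClassSums 𝔽
  open Bounded n public

  𝓝-cong : ∀ j {ψ φ} → (∀ u → ψ u ≡ φ u) → 𝓝 j ψ ≡ 𝓝 j φ
  𝓝-cong j e = ∑-cong (primePowers n) (λ x →
    cong (λ m → weight (proj₁ x) * (𝟙 (length (power x) ℕ.≟ j) * (ν (power x) * m))) (e (cls (power x))))

  𝓝-mono : ∀ j {ψ φ} → (∀ u → ψ u ≤ φ u) → 𝓝 j ψ ≤ 𝓝 j φ
  𝓝-mono j e = ∑-mono (primePowers n) (λ x → ℕ.*-monoʳ-≤ (weight (proj₁ x))
    (ℕ.*-monoʳ-≤ (𝟙 (length (power x) ℕ.≟ j)) (ℕ.*-monoʳ-≤ (ν (power x)) (e (cls (power x))))))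

  𝓝-+ : ∀ j ψ φ → 𝓝 j (λ u → ψ u + φ u) ≡ 𝓝 j ψ + 𝓝 j φ
  𝓝-+ j ψ φ = trans (∑-cong (primePowers n) (λ x →
    distribute (weight (proj₁ x)) (𝟙 (length (power x) ℕ.≟ j)) (ν (power x)) (ψ (cls (power x))) (φ (cls (power x)))))
    (∑-+ (primePowers n) _ _)
    where
    distribute : ∀ w i v a b → w * (i * (v * (a + b))) ≡ w * (i * (v * a)) + w * (i * (v * b))
    distribute = solve-∀

  𝓝-*ʳ : ∀ j m ψ → 𝓝 j (λ u → ψ u * m) ≡ 𝓝 j ψ * m
  𝓝-*ʳ j m ψ = trans (∑-cong (primePowers n) (λ x →
    collect (weight (proj₁ x)) (𝟙 (length (power x) ℕ.≟ j)) (ν (power x)) (ψ (cls (power x))) m))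
    (∑-*ʳ (primePowers n) m _)
    where
    collect : ∀ w i v a m → w * (i * (v * (a * m))) ≡ w * (i * (v * a)) * m
    collect = solve-∀

  𝓝-*ˡ : ∀ j m ψ → 𝓝 j (λ u → m * ψ u) ≡ m * 𝓝 j ψ
  𝓝-*ˡ j m ψ = trans (𝓝-cong j (λ u → ℕ.*-comm m (ψ u))) (trans (𝓝-*ʳ j m ψ) (ℕ.*-comm _ m))

  -- `E k` is the common shape of every tail on which `𝓜` is uniform; its factor κ·q^i is the number
  -- of polynomials of degree i + 1 with nonzero constant term. It is never evaluated, only
  -- eliminated.
  T E : ℕ → ℕ
  T j = 𝓝 j (λ _ → 1)
  E k = diag (λ j i → 𝓝 j (λ _ → κ * q ^ i)) k

  𝓝-const : ∀ j m → 𝓝 j (λ _ → m) ≡ T j * m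
  𝓝-const j m = trans (𝓝-cong j (λ _ → sym (ℕ.*-identityˡ m))) (𝓝-*ʳ j m (λ _ → 1))

  uniform-tail : ∀ s k (ψ : G → ℕ) C → (∀ i u → 𝓜 (s + i) (λ v → ψ (u ⊞ v)) ≡ κ * (q ^ i * C)) →
                 diag (λ j i → 𝓝 j (λ u → 𝓜 (s + i) (λ v → ψ (u ⊞ v)))) k ≡ E k * C
  uniform-tail s k ψ C e = trans
    (diag-cong k (λ j i → trans (𝓝-cong j (λ u → trans (e i u) (sym (ℕ.*-assoc κ (q ^ i) C)))) (𝓝-*ʳ j C (λ _ → κ * q ^ i))))
    (diag-*ʳ (λ j i → 𝓝 j (λ _ → κ * q ^ i)) C k)

  -- The degree identity for the constant test function 1; it serves to eliminate `E k`.
  total-mass : ∀ k → suc k ≤ n → suc k * (κ * q ^ k) ≡ T (suc k) + E k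
  total-mass k k<n = begin
    suc k * (κ * q ^ k)
      ≡⟨ cong (suc k *_) (𝓜-1+-total k) ⟨
    suc k * 𝓜 (suc k) (λ _ → 1)
      ≡⟨ degree-identity (suc k) (λ _ → 1) k<n ⟩
    𝓝 (suc k) (λ _ → 𝓜 0 (λ _ → 1)) + diag (λ j i → 𝓝 j (λ _ → 𝓜 (1 + i) (λ _ → 1))) k
      ≡⟨ cong₂ _+_ (𝓝-cong (suc k) (λ _ → 𝓜-0 (λ _ → 1)))
           (diag-cong k (λ j i → 𝓝-cong j (λ _ → 𝓜-1+-total i))) ⟩
    T (suc k) + E k
      ∎

  -- Both coordinates are additive, take each nonzero value once in degree 1, and are
  -- equidistributed from degree 2 on. Nothing else about them enters.
  module Marginal (π : G → K) (π-⊞ : ∀ u v → π (u ⊞ v) ≡ π u ⊕ π v) (π-𝟎 : π (𝟎 , 𝟎) ≡ 𝟎)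
                  (𝓜-1-π : ∀ ρ → 𝓜 1 (ρ ∘ π) ≡ S* ρ)
                  (𝓜-2+-π : ∀ k ρ → 𝓜 (2 + k) (ρ ∘ π) ≡ κ * (q ^ k * S ρ)) where

    𝓜-π-shift : ∀ m ρ u → 𝓜 m (λ v → ρ (π (u ⊞ v))) ≡ 𝓜 m ((λ x → ρ (π u ⊕ x)) ∘ π)
    𝓜-π-shift m ρ u = 𝓜-cong m (λ v → cong ρ (π-⊞ u v))

    𝓜-0-π-shift : ∀ ρ u → 𝓜 0 (λ v → ρ (π (u ⊞ v))) ≡ ρ (π u)
    𝓜-0-π-shift ρ u = trans (𝓜-π-shift 0 ρ u) (trans (𝓜-0 ((λ x → ρ (π u ⊕ x)) ∘ π))
      (cong ρ (trans (cong (π u ⊕_) π-𝟎) (+-identityʳ _))))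

    𝓜-1-π-shift : ∀ ρ u → 𝓜 1 (λ v → ρ (π (u ⊞ v))) + ρ (π u) ≡ S ρ
    𝓜-1-π-shift ρ u = begin
      𝓜 1 (λ v → ρ (π (u ⊞ v))) + ρ (π u)                      ≡⟨ cong₂ _+_ (trans (𝓜-π-shift 1 ρ u) (𝓜-1-π _)) (cong ρ (sym (+-identityʳ _))) ⟩
      S* (λ x → ρ (π u ⊕ x)) + ρ (π u ⊕ 𝟎)                     ≡⟨ S*+𝟎 (λ x → ρ (π u ⊕ x)) ⟩
      S (λ x → ρ (π u ⊕ x))                                    ≡⟨ S-shift (π u) ρ ⟩
      S ρ                                                      ∎

    -- A nontrivial character of one coordinate has L-series 1 - t and hence count -1 in every
    -- degree, which is the term `ρ 𝟎`. In the induction step `total-mass` removes `E k`, while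
    -- `linear` and the induction hypothesis remove `Y`.
    marginal : ∀ k → suc k ≤ n → ∀ ρ → 𝓝 (suc k) (ρ ∘ π) + ρ 𝟎 ≡ q ^ k * S ρ
    marginal zero 1≤n ρ = begin
      𝓝 1 (ρ ∘ π) + ρ 𝟎                                        ≡⟨ cong (_+ ρ 𝟎) (begin
        𝓝 1 (ρ ∘ π)                                               ≡⟨ 𝓝-cong 1 (𝓜-0-π-shift ρ) ⟨
        𝓝 1 (λ u → 𝓜 0 (λ v → ρ (π (u ⊞ v))))                     ≡⟨ ℕ.+-identityʳ _ ⟨
        𝓝 1 (λ u → 𝓜 0 (λ v → ρ (π (u ⊞ v)))) + 0                 ≡⟨ degree-identity 1 (ρ ∘ π) 1≤n ⟨
        1 * 𝓜 1 (ρ ∘ π)                                           ≡⟨ ℕ.*-identityˡ _ ⟩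
        𝓜 1 (ρ ∘ π)                                               ≡⟨ 𝓜-1-π ρ ⟩
        S* ρ                                                      ∎) ⟩
      S* ρ + ρ 𝟎                                               ≡⟨ S*+𝟎 ρ ⟩
      S ρ                                                      ≡⟨ ℕ.*-identityˡ _ ⟨
      1 * S ρ                                                  ∎
    marginal (suc k) k<n ρ =
      combine k κ q (q ^ k) (S ρ) (𝓝 (2 + k) (ρ ∘ π)) Y (𝓝 (suc k) (ρ ∘ π)) (T (suc k)) (E k) (ρ 𝟎)
        κ+1 recursion linear (total-mass k (ℕ.<⇒≤ k<n)) (marginal k (ℕ.<⇒≤ k<n) ρ)
      where
      Y : ℕ
      Y = 𝓝 (suc k) (λ u → 𝓜 1 (λ v → ρ (π (u ⊞ v))))
      recursion : (2 + k) * (κ * (q ^ k * S ρ)) ≡ 𝓝 (2 + k) (ρ ∘ π) + (Y + E k * S ρ)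
      recursion = begin
        (2 + k) * (κ * (q ^ k * S ρ))      ≡⟨ cong ((2 + k) *_) (𝓜-2+-π k ρ) ⟨
        (2 + k) * 𝓜 (2 + k) (ρ ∘ π)        ≡⟨ degree-identity (2 + k) (ρ ∘ π) k<n ⟩
        _                                  ≡⟨ cong₂ (λ s t → s + (Y + t)) (𝓝-cong (2 + k) (𝓜-0-π-shift ρ))
                                                (uniform-tail 2 k (ρ ∘ π) (S ρ) (λ i u → trans (𝓜-π-shift (2 + i) ρ u)
                                                  (trans (𝓜-2+-π i _) (cong (λ s → κ * (q ^ i * s)) (S-shift (π u) ρ))))) ⟩
        𝓝 (2 + k) (ρ ∘ π) + (Y + E k * S ρ) ∎
      linear : Y + 𝓝 (suc k) (ρ ∘ π) ≡ T (suc k) * S ρ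
      linear = trans (sym (𝓝-+ (suc k) (λ u → 𝓜 1 (λ v → ρ (π (u ⊞ v)))) (ρ ∘ π))) (trans (𝓝-cong (suc k) (𝓜-1-π-shift ρ)) (𝓝-const (suc k) (S ρ)))
      combine : ∀ k κ q Q s X Y Z t e r → κ + 1 ≡ q → (2 + k) * (κ * (Q * s)) ≡ X + (Y + e * s) → Y + Z ≡ t * s →
                suc k * (κ * Q) ≡ t + e → Z + r ≡ Q * s → X + r ≡ q * Q * s
      -- Adding `t * s + e * s` to both sides keeps the elimination free of subtraction.
      combine k κ .(κ + 1) Q s X Y Z t e r refl h₁ h₂ h₃ h₄ = ℕ.+-cancelʳ-≡ (t * s + e * s) _ _ (begin
        X + r + (t * s + e * s)                            ≡⟨ cong (λ m → X + r + (m + e * s)) h₂ ⟨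
        X + r + (Y + Z + e * s)                            ≡⟨ p₁ X r Y Z (e * s) ⟩
        (X + (Y + e * s)) + (Z + r)                        ≡⟨ cong₂ _+_ (sym h₁) h₄ ⟩
        (2 + k) * (κ * (Q * s)) + Q * s                    ≡⟨ p₂ k κ Q s ⟩
        (κ + 1) * Q * s + (suc k * (κ * Q)) * s            ≡⟨ cong (λ m → (κ + 1) * Q * s + m * s) h₃ ⟩
        (κ + 1) * Q * s + (t + e) * s                      ≡⟨ cong ((κ + 1) * Q * s +_) (ℕ.*-distribʳ-+ s t e) ⟩
        (κ + 1) * Q * s + (t * s + e * s)                  ∎)
        where
        p₁ : ∀ X r Y Z w → X + r + (Y + Z + w) ≡ (X + (Y + w)) + (Z + r)
        p₁ = solve-∀
        p₂ : ∀ k κ Q s → (2 + k) * (κ * (Q * s)) + Q * s ≡ (κ + 1) * Q * s + (suc k * (κ * Q)) * s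
        p₂ = solve-∀

  module Subleading = Marginal proj₁ (λ _ _ → refl) refl (λ ρ → 𝓜-1 (ρ ∘ proj₁)) 𝓜-2+-subleading
  module LogDerivative = Marginal proj₂ (λ _ _ → refl) refl
    (λ ρ → trans (𝓜-1 (ρ ∘ proj₂)) (S*-⁻¹ ρ)) 𝓜-2+-logDerivative

  axes : (G → ℕ) → ℕ
  axes ψ = row ψ 𝟎 + column ψ 𝟎

  𝓜-0-shift : ∀ ψ u → 𝓜 0 (λ v → ψ (u ⊞ v)) ≡ ψ u
  𝓜-0-shift ψ u = trans (𝓜-0 (λ v → ψ (u ⊞ v))) (cong ψ (cong₂ _,_ (+-identityʳ _) (+-identityʳ _)))

  𝓜-2-shift : ∀ ψ u → 𝓜 2 (λ v → ψ (u ⊞ v)) + (row ψ (proj₁ u) + column ψ (proj₂ u)) ≡ S₂ ψ + q * ψ u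
  𝓜-2-shift ψ u@(a , b) = begin
    𝓜 2 ψᵤ + (row ψ a + column ψ b)
      ≡⟨ cong₂ (λ s t → 𝓜 2 ψᵤ + (s + t))
           (trans (cong (row ψ) (sym (+-identityʳ a))) (sym (S-shift b (λ y → ψ (a ⊕ 𝟎 , y)))))
           (trans (cong (column ψ) (sym (+-identityʳ b))) (sym (S-shift a (λ x → ψ (x , b ⊕ 𝟎))))) ⟩
    𝓜 2 ψᵤ + (row ψᵤ 𝟎 + column ψᵤ 𝟎)
      ≡⟨ 𝓜-2-axes ψᵤ ⟩
    S₂ ψᵤ + q * ψᵤ (𝟎 , 𝟎)
      ≡⟨ cong₂ (λ s t → s + q * t) (S₂-shift u ψ) (cong ψ (cong₂ _,_ (+-identityʳ a) (+-identityʳ b))) ⟩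
    S₂ ψ + q * ψ u
      ∎
    where
    ψᵤ : G → ℕ
    ψᵤ v = ψ (u ⊞ v)

  -- Cofactors of degree 0, 1 and 2 give the terms `𝓝 (3 + k) ψ`, `𝓝 (2 + k) (A ψ)` and `P`; the
  -- remaining degrees are uniform and cancel through `total-mass`. The axis corrections inside `P`
  -- depend on one coordinate each, so `marginal` evaluates them.
  recurrence : ∀ k → 3 + k ≤ n → ∀ ψ →
               𝓝 (3 + k) ψ + 𝓝 (2 + k) (A ψ) + q * 𝓝 (1 + k) ψ + axes ψ ≡ 2 * (q ^ suc k * S₂ ψ)
  recurrence k k<n ψ =
    combine k κ q (q ^ k) (S₂ ψ) (𝓝 (3 + k) ψ) (𝓝 (2 + k) (A ψ)) P (𝓝 (1 + k) ψ)
      (𝓝 (1 + k) (row ψ ∘ proj₁)) (𝓝 (1 + k) (column ψ ∘ proj₂)) (row ψ 𝟎) (column ψ 𝟎) (T (suc k)) (E k)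
      κ+1 recursion linear
      (Subleading.marginal k k≤n (row ψ))
      (trans (LogDerivative.marginal k k≤n (column ψ)) (cong (q ^ k *_) (S₂-swap ψ)))
      (total-mass k k≤n)
    where
    k≤n : suc k ≤ n
    k≤n = ℕ.<⇒≤ (ℕ.<⇒≤ k<n)
    P : ℕ
    P = 𝓝 (1 + k) (λ u → 𝓜 2 (λ v → ψ (u ⊞ v)))
    recursion : (3 + k) * (κ * (q ^ k * S₂ ψ)) ≡ 𝓝 (3 + k) ψ + (𝓝 (2 + k) (A ψ) + (P + E k * S₂ ψ))
    recursion = begin
      (3 + k) * (κ * (q ^ k * S₂ ψ))      ≡⟨ cong ((3 + k) *_) (𝓜-3+ k ψ) ⟨
      (3 + k) * 𝓜 (3 + k) ψ               ≡⟨ degree-identity (3 + k) ψ k<n ⟩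
      _                                   ≡⟨ cong₂ (λ s t → s + t) (𝓝-cong (3 + k) (𝓜-0-shift ψ))
                                               (cong₂ (λ s t → s + (P + t)) (𝓝-cong (2 + k) (λ u → 𝓜-1 (λ v → ψ (u ⊞ v))))
                                                 (uniform-tail 3 k ψ (S₂ ψ) (λ i u → trans (𝓜-3+ i (λ v → ψ (u ⊞ v)))
                                                   (cong (λ s → κ * (q ^ i * s)) (S₂-shift u ψ))))) ⟩
      𝓝 (3 + k) ψ + (𝓝 (2 + k) (A ψ) + (P + E k * S₂ ψ)) ∎
    linear : P + (𝓝 (1 + k) (row ψ ∘ proj₁) + 𝓝 (1 + k) (column ψ ∘ proj₂)) ≡ T (suc k) * S₂ ψ + q * 𝓝 (1 + k) ψ
    linear = begin
      P + (𝓝 (1 + k) (row ψ ∘ proj₁) + 𝓝 (1 + k) (column ψ ∘ proj₂))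
        ≡⟨ cong (P +_) (𝓝-+ (1 + k) (row ψ ∘ proj₁) (column ψ ∘ proj₂)) ⟨
      P + 𝓝 (1 + k) (λ u → row ψ (proj₁ u) + column ψ (proj₂ u))
        ≡⟨ 𝓝-+ (1 + k) (λ u → 𝓜 2 (λ v → ψ (u ⊞ v))) (λ u → row ψ (proj₁ u) + column ψ (proj₂ u)) ⟨
      𝓝 (1 + k) (λ u → 𝓜 2 (λ v → ψ (u ⊞ v)) + (row ψ (proj₁ u) + column ψ (proj₂ u)))
        ≡⟨ 𝓝-cong (1 + k) (𝓜-2-shift ψ) ⟩
      𝓝 (1 + k) (λ u → S₂ ψ + q * ψ u)
        ≡⟨ 𝓝-+ (1 + k) (λ _ → S₂ ψ) (λ u → q * ψ u) ⟩
      𝓝 (1 + k) (λ _ → S₂ ψ) + 𝓝 (1 + k) (λ u → q * ψ u)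
        ≡⟨ cong₂ _+_ (𝓝-const (1 + k) (S₂ ψ)) (𝓝-*ˡ (1 + k) q ψ) ⟩
      T (suc k) * S₂ ψ + q * 𝓝 (1 + k) ψ
        ∎
    combine : ∀ k κ q Q s X Y P W R₁ R₂ z₁ z₂ t e → κ + 1 ≡ q →
              (3 + k) * (κ * (Q * s)) ≡ X + (Y + (P + e * s)) → P + (R₁ + R₂) ≡ t * s + q * W →
              R₁ + z₁ ≡ Q * s → R₂ + z₂ ≡ Q * s → suc k * (κ * Q) ≡ t + e →
              X + Y + q * W + (z₁ + z₂) ≡ 2 * (q * Q * s)
    combine k κ .(κ + 1) Q s X Y P W R₁ R₂ z₁ z₂ t e refl h₁ h₂ h₃ h₄ h₅ = ℕ.+-cancelʳ-≡ (t * s + e * s) _ _ (begin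
      X + Y + (κ + 1) * W + (z₁ + z₂) + (t * s + e * s)          ≡⟨ p₁ X Y ((κ + 1) * W) (z₁ + z₂) (t * s) (e * s) ⟩
      X + Y + (z₁ + z₂) + e * s + (t * s + (κ + 1) * W)          ≡⟨ cong (X + Y + (z₁ + z₂) + e * s +_) h₂ ⟨
      X + Y + (z₁ + z₂) + e * s + (P + (R₁ + R₂))                ≡⟨ p₂ X Y z₁ z₂ (e * s) P R₁ R₂ ⟩
      (X + (Y + (P + e * s))) + ((R₁ + z₁) + (R₂ + z₂))          ≡⟨ cong₂ _+_ (sym h₁) (cong₂ _+_ h₃ h₄) ⟩
      -- The constant 2q arises here: 3 + k exceeds 1 + k by two copies of κ, and each of the two
      -- marginals adds 1.
      (3 + k) * (κ * (Q * s)) + (Q * s + Q * s)                  ≡⟨ p₃ k κ Q s ⟩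
      2 * ((κ + 1) * Q * s) + (suc k * (κ * Q)) * s              ≡⟨ cong (λ m → 2 * ((κ + 1) * Q * s) + m * s) h₅ ⟩
      2 * ((κ + 1) * Q * s) + (t + e) * s                        ≡⟨ cong (2 * ((κ + 1) * Q * s) +_) (ℕ.*-distribʳ-+ s t e) ⟩
      2 * ((κ + 1) * Q * s) + (t * s + e * s)                    ∎)
      where
      p₁ : ∀ X Y w z a b → X + Y + w + z + (a + b) ≡ X + Y + z + b + (a + w)
      p₁ = solve-∀
      p₂ : ∀ X Y z₁ z₂ w P R₁ R₂ → X + Y + (z₁ + z₂) + w + (P + (R₁ + R₂)) ≡ (X + (Y + (P + w))) + ((R₁ + z₁) + (R₂ + z₂))
      p₂ = solve-∀
      p₃ : ∀ k κ Q s → (3 + k) * (κ * (Q * s)) + (Q * s + Q * s) ≡ 2 * ((κ + 1) * Q * s) + (suc k * (κ * Q)) * s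
      p₃ = solve-∀

  -- The diagonal has a single term in degree 1, so the weighted count is the plain count of linear
  -- polynomials.
  𝓝-1 : 1 ≤ n → ∀ ψ → 𝓝 1 ψ ≡ S* (λ c → ψ (c , c ⁻¹))
  𝓝-1 1≤n ψ = begin
    𝓝 1 ψ                                        ≡⟨ 𝓝-cong 1 (𝓜-0-shift ψ) ⟨
    𝓝 1 (λ u → 𝓜 0 (λ v → ψ (u ⊞ v)))            ≡⟨ ℕ.+-identityʳ _ ⟨
    𝓝 1 (λ u → 𝓜 0 (λ v → ψ (u ⊞ v))) + 0        ≡⟨ degree-identity 1 ψ 1≤n ⟨
    1 * 𝓜 1 ψ                                    ≡⟨ ℕ.*-identityˡ _ ⟩
    𝓜 1 ψ                                        ≡⟨ 𝓜-1 ψ ⟩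
    S* (λ c → ψ (c , c ⁻¹))                      ∎

  -- Eliminating 𝓝 (4 + k) (A ψ) and 𝓝 (2 + k) (A ψ) from three instances of the recurrence.
  lower-bound : ∀ k → 5 + k ≤ n → ∀ ψ →
    4 * (q ^ (2 + k) * S₂ ψ) + 2 * S₂ ψ ≤
    𝓝 (5 + k) ψ + (q + 1) * 𝓝 (3 + k) ψ + q * (q * 𝓝 (1 + k) ψ) + (q + 2) * axes ψ
  lower-bound k k≤n ψ =
    combine κ q (q ^ k) (S₂ ψ) (𝓝 (5 + k) ψ) (𝓝 (4 + k) (A ψ)) (𝓝 (3 + k) ψ) (axes ψ) (𝓝 (3 + k) (A (A ψ)))
      (𝓝 (2 + k) (A ψ)) (axes (A ψ)) (𝓝 (1 + k) ψ) κ+1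
      (recurrence (2 + k) k≤n ψ)
      (trans (recurrence (suc k) (ℕ.<⇒≤ k≤n) (A ψ)) (cong (λ s → 2 * (q ^ (2 + k) * s)) (S₂-A ψ)))
      (recurrence k (ℕ.<⇒≤ (ℕ.<⇒≤ k≤n)) ψ)
      axes-A
      (subst (_≤ 𝓝 (3 + k) (A (A ψ))) (𝓝-*ˡ (3 + k) κ ψ) (𝓝-mono (3 + k) (A-A ψ)))
    where
    axes-A : axes (A ψ) + axes ψ ≡ 2 * S₂ ψ
    axes-A = trans (exchange (row (A ψ) 𝟎) (column (A ψ) 𝟎) (row ψ 𝟎) (column ψ 𝟎))
                   (trans (cong₂ _+_ (row-A ψ) (column-A ψ)) (double (S₂ ψ)))
      where
      exchange : ∀ a b c d → (a + b) + (c + d) ≡ (a + c) + (b + d)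
      exchange = solve-∀
      double : ∀ s → s + s ≡ 2 * s
      double = solve-∀
    combine : ∀ κ r Q s X C₄ N₃ z D C₂ zA N₁ → κ + 1 ≡ r →
              X + C₄ + r * N₃ + z ≡ 2 * (r * (r * (r * Q)) * s) →
              C₄ + D + r * C₂ + zA ≡ 2 * (r * (r * Q) * (κ * s)) →
              N₃ + C₂ + r * N₁ + z ≡ 2 * (r * Q * s) →
              zA + z ≡ 2 * s → κ * N₃ ≤ D →
              4 * (r * (r * Q) * s) + 2 * s ≤ X + (r + 1) * N₃ + r * (r * N₁) + (r + 2) * z
    -- The combination is h₁ + r·h₃ + h₄ - h₂, with `R` the right side of h₂. Adding `κ * N₃` on
    -- both sides lets h₅ exchange it for `D`, which completes the left side of h₂.
    combine κ .(κ + 1) Q s X C₄ N₃ z D C₂ zA N₁ refl h₁ h₂ h₃ h₄ h₅ = ℕ.+-cancelʳ-≤ (κ * N₃ + R) _ _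
      (ℕ.≤-trans (ℕ.≤-reflexive lower) (ℕ.≤-trans (ℕ.+-monoʳ-≤ (G′ + (C₄ + r * C₂ + zA)) h₅) (ℕ.≤-reflexive upper)))
      where
      r = κ + 1
      R = 2 * (r * (r * Q) * (κ * s))
      G′ = X + (r + 1) * N₃ + r * (r * N₁) + (r + 2) * z + κ * N₃
      p₁ : ∀ κ Q s n → let r = κ + 1 in 4 * (r * (r * Q) * s) + 2 * s + (κ * n + 2 * (r * (r * Q) * (κ * s))) ≡
           2 * (r * (r * (r * Q)) * s) + r * (2 * (r * Q * s)) + 2 * s + κ * n
      p₁ = solve-∀
      p₂ : ∀ κ X C₄ n₃ z C₂ n₁ zA → let r = κ + 1 in
           (X + C₄ + r * n₃ + z) + r * (n₃ + C₂ + r * n₁ + z) + (zA + z) + κ * n₃ ≡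
           X + (r + 1) * n₃ + r * (r * n₁) + (r + 2) * z + κ * n₃ + (C₄ + r * C₂ + zA) + κ * n₃
      p₂ = solve-∀
      p₃ : ∀ g n a D b c → g + n + (a + b + c) + D ≡ g + (n + (a + D + b + c))
      p₃ = solve-∀
      lower : 4 * (r * (r * Q) * s) + 2 * s + (κ * N₃ + R) ≡ G′ + (C₄ + r * C₂ + zA) + κ * N₃
      lower = trans (p₁ κ Q s N₃) (trans
        (cong (_+ κ * N₃) (cong₂ _+_ (cong₂ (λ a b → a + r * b) (sym h₁) (sym h₃)) (sym h₄)))
        (p₂ κ X C₄ N₃ z C₂ N₁ zA))
      upper : G′ + (C₄ + r * C₂ + zA) + D ≡ X + (r + 1) * N₃ + r * (r * N₁) + (r + 2) * z + (κ * N₃ + R)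
      upper = trans (p₃ (X + (r + 1) * N₃ + r * (r * N₁) + (r + 2) * z) (κ * N₃) C₄ D (r * C₂) zA)
                    (cong (λ w → X + (r + 1) * N₃ + r * (r * N₁) + (r + 2) * z + (κ * N₃ + w)) h₂)

-- Positivity of the counts and extraction of the irreducible polynomial.

-- Degree 5 stands apart because its lower bound involves `𝓝 1`, below the range of `upper-bound`.
prime-cases : ∀ {n} → Prime n → n ≢ 2 → n ≢ 3 → n ≡ 5 ⊎ (∃[ k ] n ≡ 7 + k)
prime-cases {0} p _ _ = ⊥-elim (¬prime[0] p)
prime-cases {1} p _ _ = ⊥-elim (¬prime[1] p)
prime-cases {2} p n≢2 _ = ⊥-elim (n≢2 refl)
prime-cases {3} p _ n≢3 = ⊥-elim (n≢3 refl)
prime-cases {4} p _ _ with prime⇒irreducible p {2} (divides 2 refl)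
... | inj₁ ()
... | inj₂ ()
prime-cases {5} p _ _ = inj₁ refl
prime-cases {6} p _ _ with prime⇒irreducible p {3} (divides 2 refl)
... | inj₁ ()
... | inj₂ ()
prime-cases {suc (suc (suc (suc (suc (suc (suc k))))))} p _ _ = inj₂ (k , refl)

module Existence {K : Set} (𝔽 : FiniteFieldOn K) where
  open Data.Nat using (_*_)
  open ClassSums 𝔽

  2≤q : 2 ≤ q
  2≤q = subst (2 ≤_) κ+1 (ℕ.+-monoˡ-≤ 1 1≤κ)

  δ : G → G → ℕ
  δ (a , b) (x , y) = 𝟙 (x ≟ᴷ a) * 𝟙 (y ≟ᴷ b)

  S-𝟙 : ∀ a → S (λ x → 𝟙 (x ≟ᴷ a)) ≡ 1
  S-𝟙 a = trans (∑-cong elements (λ x → sym (ℕ.*-identityʳ _))) (enumerates a (λ _ → 1))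

  row-δ : ∀ a b x → row (δ (a , b)) x ≡ 𝟙 (x ≟ᴷ a)
  row-δ a b x = trans (∑-*ˡ elements (𝟙 (x ≟ᴷ a)) _) (trans (cong (𝟙 (x ≟ᴷ a) *_) (S-𝟙 b)) (ℕ.*-identityʳ _))

  column-δ : ∀ a b y → column (δ (a , b)) y ≡ 𝟙 (y ≟ᴷ b)
  column-δ a b y = trans (∑-*ʳ elements (𝟙 (y ≟ᴷ b)) _) (trans (cong (_* 𝟙 (y ≟ᴷ b)) (S-𝟙 a)) (ℕ.*-identityˡ _))

  S₂-δ : ∀ g → S₂ (δ g) ≡ 1
  S₂-δ (a , b) = trans (∑-cong elements (row-δ a b)) (S-𝟙 a)

  S*-δ : ∀ a b → S* (λ c → δ (a , b) (c , c ⁻¹)) ≡ μ a * 𝟙 (a ⁻¹ ≟ᴷ b)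
  S*-δ a b = trans (∑-cong elements (λ c → exchange (μ c) (𝟙 (c ≟ᴷ a)) (𝟙 (c ⁻¹ ≟ᴷ b)))) (enumerates a _)
    where
    exchange : ∀ x y z → x * (y * z) ≡ y * (x * z)
    exchange = solve-∀

  module _ (n : ℕ) where
    open Recurrence 𝔽 n

    -- The two counts of lower degree in the recurrence are dropped. The axes are kept, since they
    -- have to absorb `(q + 2) * axes` from the lower bound.
    upper-bound : ∀ k → 3 + k ≤ n → ∀ g → 𝓝 (3 + k) (δ g) + axes (δ g) ≤ 2 * q ^ suc k
    upper-bound k k≤n g = ℕ.≤-trans (ℕ.+-monoˡ-≤ (axes (δ g)) (ℕ.≤-trans (ℕ.m≤m+n (𝓝 (3 + k) (δ g)) (𝓝 (2 + k) (A (δ g)))) (ℕ.m≤m+n _ (q * 𝓝 (1 + k) (δ g)))))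
      (ℕ.≤-reflexive (trans (recurrence k k≤n (δ g))
        (cong (2 *_) (trans (cong (q ^ suc k *_) (S₂-δ g)) (ℕ.*-identityʳ (q ^ suc k))))))

    lower-bound-δ : ∀ k → 5 + k ≤ n → ∀ g →
      4 * q ^ (2 + k) + 2 ≤ 𝓝 (5 + k) (δ g) + (q + 1) * 𝓝 (3 + k) (δ g) + q * (q * 𝓝 (1 + k) (δ g)) + (q + 2) * axes (δ g)
    lower-bound-δ k k≤n g = subst (_≤ 𝓝 (5 + k) (δ g) + (q + 1) * 𝓝 (3 + k) (δ g) + q * (q * 𝓝 (1 + k) (δ g)) + (q + 2) * axes (δ g))
      (trans (cong (λ s → 4 * (q ^ (2 + k) * s) + 2 * s) (S₂-δ g)) (cong (λ m → 4 * m + 2) (ℕ.*-identityʳ (q ^ (2 + k)))))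
      (lower-bound k k≤n (δ g))

    -- This stands in for the upper bound in degree 1. If `𝓝 1 (δ g)` is 1, then both coordinates of
    -- g are nonzero, the axes vanish, and the claim is (q - 1)² ≥ 0. Otherwise it is 0, the axes
    -- are at most 2, and q ≥ 2 suffices.
    small-terms : 1 ≤ n → ∀ g → q * (q * 𝓝 1 (δ g)) + axes (δ g) + 2 * q ≤ 2 * (q * q) + 1
    small-terms 1≤n g@(a , b) = subst₂ (λ N z → q * (q * N) + z + 2 * q ≤ 2 * (q * q) + 1)
      (sym (trans (𝓝-1 1≤n (δ g)) (S*-δ a b))) (sym (cong₂ _+_ (row-δ a b 𝟎) (column-δ a b 𝟎)))
      -- Writing q = 2 + r turns each inequality into an identity with an explicit nonnegative
      -- slack.
      (subst (λ q → q * (q * (μ a * 𝟙 (a ⁻¹ ≟ᴷ b))) + (𝟙 (𝟎 ≟ᴷ a) + 𝟙 (𝟎 ≟ᴷ b)) + 2 * q ≤ 2 * (q * q) + 1)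
        (ℕ.m+[n∸m]≡n 2≤q) (cases (q ∸ 2)))
      where
      square : ∀ r → (2 + r) * (2 + r) + (1 + r) * (1 + r) + 2 * (2 + r) ≡ 2 * ((2 + r) * (2 + r)) + 1
      square = solve-∀
      vanishing : ∀ r z → z ≤ 2 → (2 + r) * ((2 + r) * 0) + z + 2 * (2 + r) ≤ 2 * ((2 + r) * (2 + r)) + 1
      vanishing r z z≤2 = subst (λ m → m + z + 2 * (2 + r) ≤ 2 * ((2 + r) * (2 + r)) + 1) (sym (zeros r))
        (ℕ.≤-trans (ℕ.+-monoˡ-≤ (2 * (2 + r)) z≤2) (subst (2 + 2 * (2 + r) ≤_) (expand r) (ℕ.m≤m+n (2 + 2 * (2 + r)) (3 + 6 * r + 2 * (r * r)))))
        where
        zeros : ∀ r → (2 + r) * ((2 + r) * 0) ≡ 0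
        zeros = solve-∀
        expand : ∀ r → 2 + 2 * (2 + r) + (3 + 6 * r + 2 * (r * r)) ≡ 2 * ((2 + r) * (2 + r)) + 1
        expand = solve-∀
      cases : ∀ r → (2 + r) * ((2 + r) * (μ a * 𝟙 (a ⁻¹ ≟ᴷ b))) + (𝟙 (𝟎 ≟ᴷ a) + 𝟙 (𝟎 ≟ᴷ b)) + 2 * (2 + r) ≤ 2 * ((2 + r) * (2 + r)) + 1
      cases r with a ≟ᴷ 𝟎 | 𝟎 ≟ᴷ a | 𝟎 ≟ᴷ b | a ⁻¹ ≟ᴷ b
      ... | yes e | _      | yes _ | _ = vanishing r _ (ℕ.+-monoˡ-≤ 1 (𝟙≤1 _))
        where
        𝟙≤1 : ∀ {P : Set} (d : Dec P) → 𝟙 d ≤ 1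
        𝟙≤1 (yes _) = ℕ.≤-refl
        𝟙≤1 (no _)  = z≤n
      ... | yes e | yes _  | no _  | _ = vanishing r _ (s≤s z≤n)
      ... | yes e | no _   | no _  | _ = vanishing r _ z≤n
      ... | no ¬e | yes e  | _     | _ = ⊥-elim (¬e (sym e))
      ... | no ¬e | no _   | yes e | yes f = ⊥-elim (⁻¹-nonzero ¬e (trans f (sym e)))
      ... | no ¬e | no _   | yes e | no _ = vanishing r _ (s≤s z≤n)
      ... | no ¬e | no _   | no _  | no _ = vanishing r _ z≤n
      ... | no ¬e | no _   | no _  | yes _ = subst₂ _≤_ (arrange r) (square r) (ℕ.+-monoˡ-≤ (2 * (2 + r)) (ℕ.m≤m+n ((2 + r) * (2 + r)) ((1 + r) * (1 + r))))
        where
        arrange : ∀ r → (2 + r) * (2 + r) + 2 * (2 + r) ≡ (2 + r) * ((2 + r) * 1) + 0 + 2 * (2 + r)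
        arrange = solve-∀

    -- The upper bound in degree 3, taken q + 1 times, and `small-terms` bound everything except
    -- `𝓝 5` by 4q² + 1, one less than the lower bound 4q² + 2.
    positive-5 : n ≡ 5 → ∀ g → 0 < 𝓝 n (δ g)
    positive-5 refl g = combine q (𝓝 5 (δ g)) (𝓝 3 (δ g)) (𝓝 1 (δ g)) (axes (δ g))
      (lower-bound-δ 0 ℕ.≤-refl g) (upper-bound 0 (s≤s (s≤s (s≤s z≤n))) g) (small-terms (s≤s z≤n) g)
      where
      combine : ∀ q X N₃ N₁ z → 4 * (q * (q * 1)) + 2 ≤ X + (q + 1) * N₃ + q * (q * N₁) + (q + 2) * z →
                N₃ + z ≤ 2 * (q * 1) → q * (q * N₁) + z + 2 * q ≤ 2 * (q * q) + 1 → 0 < X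
      combine q X N₃ N₁ z h₁ h₂ h₃ = ℕ.+-cancelʳ-≤ (4 * (q * (q * 1)) + 2 * q + 1) 1 X (begin
        1 + (4 * (q * (q * 1)) + 2 * q + 1)                                                  ≡⟨ p₁ q ⟩
        4 * (q * (q * 1)) + 2 + 2 * q                                                          ≤⟨ ℕ.+-monoˡ-≤ (2 * q) h₁ ⟩
        X + (q + 1) * N₃ + q * (q * N₁) + (q + 2) * z + 2 * q                          ≡⟨ p₂ q X N₃ N₁ z ⟩
        X + ((q + 1) * (N₃ + z) + (q * (q * N₁) + z + 2 * q))                          ≤⟨ ℕ.+-monoʳ-≤ X (ℕ.+-mono-≤ (ℕ.*-monoʳ-≤ (q + 1) h₂) h₃) ⟩
        X + ((q + 1) * (2 * (q * 1)) + (2 * (q * q) + 1))                                ≡⟨ p₃ q X ⟩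
        X + (4 * (q * (q * 1)) + 2 * q + 1)                                                  ∎)
        where
        open ℕ.≤-Reasoning
        p₁ : ∀ q → 1 + (4 * (q * (q * 1)) + 2 * q + 1) ≡ 4 * (q * (q * 1)) + 2 + 2 * q
        p₁ = solve-∀
        p₂ : ∀ q X n m z → X + (q + 1) * n + q * (q * m) + (q + 2) * z + 2 * q ≡
                           X + ((q + 1) * (n + z) + (q * (q * m) + z + 2 * q))
        p₂ = solve-∀
        p₃ : ∀ q X → X + ((q + 1) * (2 * (q * 1)) + (2 * (q * q) + 1)) ≡ X + (4 * (q * (q * 1)) + 2 * q + 1)
        p₃ = solve-∀

    -- With B = q^(k+1), the two upper bounds use up 2(q + 2)q²B of the main term 4q³B. For q = 2
    -- these are equal, and the summand 2 in the lower bound decides.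
    positive-7+ : ∀ k → n ≡ 7 + k → ∀ g → 0 < 𝓝 n (δ g)
    positive-7+ k refl g = combine (q ∸ 2) q (q ^ suc k) (𝓝 (7 + k) (δ g)) (𝓝 (5 + k) (δ g)) (𝓝 (3 + k) (δ g)) (axes (δ g))
      (ℕ.m+[n∸m]≡n 2≤q) (lower-bound-δ (2 + k) ℕ.≤-refl g)
      (upper-bound (2 + k) (ℕ.m≤n+m (5 + k) 2) g) (upper-bound k (ℕ.m≤n+m (3 + k) 4) g)
      where
      combine : ∀ r q B X N₃ N₁ z → 2 + r ≡ q →
                4 * (q * (q * (q * B))) + 2 ≤ X + (q + 1) * N₃ + q * (q * N₁) + (q + 2) * z →
                N₃ + z ≤ 2 * (q * (q * B)) → N₁ + z ≤ 2 * B → 0 < X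
      combine r q@.(2 + r) B X N₃ N₁ z refl h₁ h₂ h₃ = ℕ.≤-trans (s≤s z≤n) (ℕ.+-cancelʳ-≤ (4 * (q * (q * (q * B)))) 2 X (begin
        2 + 4 * (q * (q * (q * B)))                                             ≡⟨ ℕ.+-comm 2 _ ⟩
        4 * (q * (q * (q * B))) + 2                                             ≤⟨ h₁ ⟩
        -- The factor `3 + 4 * r + r * r` is q² - 1, the number of copies of z still missing to
        -- apply both upper bounds.
        X + (q + 1) * N₃ + q * (q * N₁) + (q + 2) * z                           ≤⟨ ℕ.m≤m+n _ ((3 + 4 * r + r * r) * z) ⟩
        X + (q + 1) * N₃ + q * (q * N₁) + (q + 2) * z + (3 + 4 * r + r * r) * z ≡⟨ p₁ r X N₃ N₁ z ⟩
        X + ((q + 1) * (N₃ + z) + q * (q * (N₁ + z)))                           ≤⟨ ℕ.+-monoʳ-≤ X (ℕ.+-mono-≤ (ℕ.*-monoʳ-≤ (q + 1) h₂)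
                                                                                     (ℕ.*-monoʳ-≤ q (ℕ.*-monoʳ-≤ q h₃))) ⟩
        X + ((q + 1) * (2 * (q * (q * B))) + q * (q * (2 * B)))                 ≤⟨ ℕ.m≤m+n _ (2 * (r * (q * (q * B)))) ⟩
        X + ((q + 1) * (2 * (q * (q * B))) + q * (q * (2 * B))) + 2 * (r * (q * (q * B))) ≡⟨ p₂ r X B ⟩
        X + 4 * (q * (q * (q * B)))                                             ∎))
        where
        open ℕ.≤-Reasoning
        p₁ : ∀ r X n m z → let q = 2 + r in X + (q + 1) * n + q * (q * m) + (q + 2) * z + (3 + 4 * r + r * r) * z ≡
                           X + ((q + 1) * (n + z) + q * (q * (m + z)))
        p₁ = solve-∀
        p₂ : ∀ r X B → let q = 2 + r in X + ((q + 1) * (2 * (q * (q * B))) + q * (q * (2 * B))) + 2 * (r * (q * (q * B))) ≡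
                       X + 4 * (q * (q * (q * B)))
        p₂ = solve-∀

  natK : ℕ → K
  natK zero    = 𝟎
  natK (suc m) = 𝟏 ⊕ natK m

  natK-+ : ∀ m k → natK (m + k) ≡ natK m ⊕ natK k
  natK-+ zero    k = sym (+-identityˡ _)
  natK-+ (suc m) k = trans (cong (𝟏 ⊕_) (natK-+ m k)) (sym (+-assoc _ _ _))

  natK-* : ∀ m k → natK (m * k) ≡ natK m ⊙ natK k
  natK-* zero    k = sym (zeroˡ _)
  natK-* (suc m) k = trans (natK-+ k (m * k)) (trans (cong₂ _⊕_ (sym (*-identityˡ _)) (natK-* m k)) (sym (distribʳ _ _ _)))

  -- The nonzero constant term is carried through the induction because additivity of
  -- `logDerivative` depends on it.
  pow-linear : ∀ c → c ≢ 𝟎 → ∀ j → ⟦ pow (c ∷ []) j ⟧ 0 ≢ 𝟎 × cls (pow (c ∷ []) j) ≡ (natK j ⊙ c , natK j ⊙ c ⁻¹)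
  pow-linear c nz zero    = 𝟏≢𝟎 , cong₂ _,_ (sym (zeroˡ c)) (trans (zeroˡ _) (sym (zeroˡ _)))
  pow-linear c nz (suc j) with pow-linear c nz j
  ... | nz′ , e =
    (λ z → ⊙-nonzero nz nz′ (trans (sym (⟦⊗⟧ (c ∷ []) (pow (c ∷ []) j) 0)) z)) ,
    cong₂ _,_
      (trans (subleading-⊗ (c ∷ []) (pow (c ∷ []) j)) (step (cong proj₁ e) refl))
      (trans (logDerivative-⊗ (c ∷ []) (pow (c ∷ []) j) nz nz′) (step (cong proj₂ e) (*-identityˡ _)))
    where
    step : ∀ {x y y′} → x ≡ natK j ⊙ y → y′ ≡ y → y′ ⊕ x ≡ (𝟏 ⊕ natK j) ⊙ y
    step {y = y} refl refl = trans (cong (_⊕ natK j ⊙ y) (sym (*-identityˡ y))) (sym (distribʳ y 𝟏 (natK j)))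

  pow-linear-constant : ∀ c j → ⟦ pow (c ∷ []) (suc j) ⟧ 0 ≢ 𝟎 → c ≢ 𝟎
  pow-linear-constant c j nz refl = nz (trans (⟦⊗⟧ (c ∷ []) (pow (c ∷ []) j) 0) (zeroˡ _))

  Prescribed : ℕ → G → Set
  Prescribed n g = ∃[ r ] Irreducible r × length r ≡ n × ⟦ r ⟧ 0 ≢ 𝟎 × cls r ≡ g

  0<*⇒0<ˡ : ∀ m k → 0 < m * k → 0 < m
  0<*⇒0<ˡ (suc m) k _ = s≤s z≤n

  0<*⇒0<ʳ : ∀ m k → 0 < m * k → 0 < k
  0<*⇒0<ʳ m k p = 0<*⇒0<ˡ k m (subst (0 <_) (ℕ.*-comm m k) p)

  prescribed-or-linear : ∀ n → Prime n → ∀ a b → natK (n ^ 2) ≢ a ⊙ b →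
                         ∀ r k → Irreducible r → length (pow r (suc k)) ≡ n →
                         ⟦ pow r (suc k) ⟧ 0 ≢ 𝟎 → cls (pow r (suc k)) ≡ (a , b) → Prescribed n (a , b)
  prescribed-or-linear n pn a b n²≢ab r k irr len nz cl
    with prime⇒irreducible pn (divides (suc k) (trans (sym len) (length-pow r (suc k))))
  ... | inj₂ r≡n = r , irr , r≡n , subst (λ s → ⟦ s ⟧ 0 ≢ 𝟎) pow≡r nz , subst (λ s → cls s ≡ (a , b)) pow≡r cl
    where
    k≡0 : k ≡ 0
    k≡0 = ℕ.m*n≡0⇒m≡0 k (length r) {{>-nonZero (proj₁ irr)}} (ℕ.+-cancelˡ-≡ (length r) _ 0
      (trans (sym (length-pow r (suc k))) (trans len (trans (sym r≡n) (sym (ℕ.+-identityʳ _))))))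
    pow≡r : pow r (suc k) ≡ r
    pow≡r = trans (cong (λ j → pow r (suc j)) k≡0) (⊗-identityʳ r)
  prescribed-or-linear n pn a b n²≢ab (c ∷ []) k irr len nz cl | inj₁ _ = ⊥-elim (n²≢ab (begin
    natK (n ^ 2)                                    ≡⟨ cong natK (cong (n *_) (ℕ.*-identityʳ n)) ⟩
    natK (n * n)                                    ≡⟨ natK-* n n ⟩
    natK n ⊙ natK n                                 ≡⟨ *-identityʳ _ ⟨
    natK n ⊙ natK n ⊙ 𝟏                             ≡⟨ cong (natK n ⊙ natK n ⊙_) (⊙-inverseʳ c c≢𝟎) ⟨
    natK n ⊙ natK n ⊙ (c ⊙ c ⁻¹)                    ≡⟨ solve 3 (λ m x y → (m :* m :* (x :* y)) := ((m :* x) :* (m :* y))) refl (natK n) c (c ⁻¹) ⟩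
    (natK n ⊙ c) ⊙ (natK n ⊙ c ⁻¹)                  ≡⟨ cong (λ j → (natK j ⊙ c) ⊙ (natK j ⊙ c ⁻¹)) n≡k+1 ⟩
    (natK (suc k) ⊙ c) ⊙ (natK (suc k) ⊙ c ⁻¹)      ≡⟨ cong₂ _⊙_ (cong proj₁ cls≡) (cong proj₂ cls≡) ⟨
    a ⊙ b                                           ∎))
    where
    open ≡-Reasoning
    open Solver using (solve) renaming (_⊗_ to _:*_; _⊜_ to _:=_)
    c≢𝟎 : c ≢ 𝟎
    c≢𝟎 = pow-linear-constant c k nz
    n≡k+1 : n ≡ suc k
    n≡k+1 = trans (sym len) (trans (length-pow (c ∷ []) (suc k)) (ℕ.*-identityʳ (suc k)))
    cls≡ : (a , b) ≡ (natK (suc k) ⊙ c , natK (suc k) ⊙ c ⁻¹)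
    cls≡ = trans (sym cl) (proj₂ (pow-linear c c≢𝟎 (suc k)))

  -- A positive sum has a positive term, and each factor of that term, being positive, yields one of
  -- the required properties.
  existence : ∀ n → Prime n → n ≢ 2 → n ≢ 3 → ∀ a b → natK (n ^ 2) ≢ a ⊙ b → Prescribed n (a , b)
  existence n pn n≢2 n≢3 a b n²≢ab with ∑-positive (primePowers n) _ positive
    where
    positive : 0 < Bounded.𝓝 n n (δ (a , b))
    positive with prime-cases pn n≢2 n≢3
    ... | inj₁ n≡5       = positive-5 n n≡5 (a , b)
    ... | inj₂ (k , n≡)  = positive-7+ n k n≡ (a , b)
  ... | (r , k) , _ , p = prescribed-or-linear n pn a b n²≢ab r k
      (𝟙-positive (irreducible? r) (0<*⇒0<ˡ _ (length r) (0<*⇒0<ˡ (weight r) _ p)))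
      (𝟙-positive (length w ℕ.≟ n) (0<*⇒0<ˡ _ _ p₁))
      (𝟙-positive (nonzero? (⟦ w ⟧ 0)) (0<*⇒0<ˡ _ _ p₂))
      (cong₂ _,_ (𝟙-positive (subleading w ≟ᴷ a) (0<*⇒0<ˡ _ _ p₃)) (𝟙-positive (logDerivative w ≟ᴷ b) (0<*⇒0<ʳ (𝟙 (subleading w ≟ᴷ a)) _ p₃)))
    where
    w = pow r (suc k)
    p₁ = 0<*⇒0<ʳ (weight r) _ p
    p₂ = 0<*⇒0<ʳ (𝟙 (length w ℕ.≟ n)) _ p₁
    p₃ = 0<*⇒0<ʳ (ν w) _ p₂

-- Transfer between the given field and its index set.

module Transport {c ℓ} {q : ℕ} (F : FiniteField c ℓ q) where
  open FiniteField F
    using (commRing; 1≉0; inverse; enum; enum-inj; enum-surj)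
  private module F = CommutativeRing commRing
  open F using (Carrier; _≈_; 0#; 1#)
  open Poly commRing

  index : Carrier → Fin q
  index x = proj₁ (enum-surj x)

  enum-index : ∀ x → enum (index x) ≈ x
  enum-index x = proj₂ (enum-surj x)

  index-cong : ∀ {x y} → x ≈ y → index x ≡ index y
  index-cong {x} {y} e = enum-inj _ _ (F.trans (enum-index x) (F.trans e (F.sym (enum-index y))))

  index-enum : ∀ i → index (enum i) ≡ i
  index-enum i = enum-inj _ _ (enum-index (enum i))

  -- The equality of `F` is a setoid relation. On `Fin q` it becomes propositional and decidable,
  -- and the ring laws are pulled back along the injective map `enum`.
  indices : RawRing 0ℓ 0ℓ
  indices = record
    { Carrier = Fin q
    ; _≈_     = _≡_
    ; _+_     = λ i j → index (enum i F.+ enum j)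
    ; _*_     = λ i j → index (enum i F.* enum j)
    ; -_      = λ i → index (F.- enum i)
    ; 0#      = index 0#
    ; 1#      = index 1#
    }

  enum-isRingMonomorphism : IsRingMonomorphism indices F.rawRing enum
  enum-isRingMonomorphism = record
    { isRingHomomorphism = record
      { isSemiringHomomorphism = record
        { isNearSemiringHomomorphism = record
          { +-isMonoidHomomorphism = record
            { isMagmaHomomorphism = record
              { isRelHomomorphism = record { cong = λ { refl → F.refl } }
              ; homo = λ i j → enum-index _
              }
            ; ε-homo = enum-index _
            }
          ; *-homo = λ i j → enum-index _
          }
        ; 1#-homo = enum-index _
        }
      ; -‿homo = λ i → enum-index _
      }
    ; injective = enum-inj _ _
    }

  -- The decision is an argument, so that the inverse law and the value at zero are proved by
  -- matching on it.
  reciprocal : ∀ i → Dec (i ≡ index 0#) → Fin q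
  reciprocal i (yes _) = index 0#
  reciprocal i (no nz) = index (proj₁ (inverse (enum i) (λ e → nz (trans (sym (index-enum i)) (index-cong e)))))

  reciprocal-inverse : ∀ i (d : Dec (i ≡ index 0#)) → i ≢ index 0# → index (enum i F.* enum (reciprocal i d)) ≡ index 1#
  reciprocal-inverse i (yes e) nz = ⊥-elim (nz e)
  reciprocal-inverse i (no nz) _  = index-cong
    (F.trans (F.*-congˡ (enum-index _)) (proj₂ (inverse (enum i) _)))

  reciprocal-zero : (d : Dec (index 0# ≡ index 0#)) → reciprocal (index 0#) d ≡ index 0#
  reciprocal-zero (yes _) = refl
  reciprocal-zero (no nz) = ⊥-elim (nz refl)

  𝔽 : FiniteFieldOn (Fin q)
  𝔽 = record
    { _⊕_               = RawRing._+_ indices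
    ; _⊙_               = RawRing._*_ indices
    ; ⊖_                = RawRing.-_ indices
    ; _⁻¹               = λ i → reciprocal i (i Fin.≟ index 0#)
    ; 𝟎                 = index 0#
    ; 𝟏                 = index 1#
    ; isCommutativeRing = RingMonomorphism.isCommutativeRing enum-isRingMonomorphism F.isCommutativeRing
    ; 𝟏≢𝟎               = λ e → 1≉0 (F.trans (F.sym (enum-index 1#)) (F.trans (F.reflexive (cong enum e)) (enum-index 0#)))
    ; ⊙-inverseʳ        = λ i → reciprocal-inverse i (i Fin.≟ index 0#)
    ; 𝟎⁻¹≡𝟎             = reciprocal-zero (index 0# Fin.≟ index 0#)
    ; _≟ᴷ_              = Fin._≟_
    ; elements          = allFin q
    ; ∈-elements        = ∈-allFin
    ; enumerates        = λ i f → ∑-δ Fin._≟_ (allFin q) i f (allFin⁺ q) (∈-allFin i)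
    }

  open ClassSums 𝔽 hiding (q)
  open Existence 𝔽

  index-+ : ∀ x y → index (x F.+ y) ≡ index x ⊕ index y
  index-+ x y = index-cong (F.+-cong (F.sym (enum-index x)) (F.sym (enum-index y)))

  index-* : ∀ x y → index (x F.* y) ≡ index x ⊙ index y
  index-* x y = index-cong (F.*-cong (F.sym (enum-index x)) (F.sym (enum-index y)))

  index-injective : ∀ {x y} → index x ≡ index y → x ≈ y
  index-injective {x} {y} e = F.trans (F.sym (enum-index x)) (F.trans (F.reflexive (cong enum e)) (enum-index y))

  index-natR : ∀ m → index (natR m) ≡ natK m
  index-natR zero    = refl
  index-natR (suc m) = trans (index-+ 1# (natR m)) (cong (𝟏 ⊕_) (index-natR m))

  coefficients : List Carrier → Series
  coefficients []       = 0ₛ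
  coefficients (x ∷ xs) = cons (index x) (coefficients xs)

  coefficients-cong : ∀ {xs ys} → Pointwise _≈_ xs ys → coefficients xs ≗ coefficients ys
  coefficients-cong []       n       = refl
  coefficients-cong (e ∷ es) zero    = index-cong e
  coefficients-cong (e ∷ es) (suc n) = coefficients-cong es n

  coefficients-addP : ∀ xs ys → coefficients (addP xs ys) ≗ coefficients xs +ₛ coefficients ys
  coefficients-addP []       ys       n       = sym (+-identityˡ _)
  coefficients-addP (x ∷ xs) []       n       = sym (+-identityʳ _)
  coefficients-addP (x ∷ xs) (y ∷ ys) zero    = index-+ x y
  coefficients-addP (x ∷ xs) (y ∷ ys) (suc n) = coefficients-addP xs ys n

  coefficients-scale : ∀ x ys → coefficients (map (x F.*_) ys) ≗ index x · coefficients ys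
  coefficients-scale x []       n       = sym (zeroʳ _)
  coefficients-scale x (y ∷ ys) zero    = index-* x y
  coefficients-scale x (y ∷ ys) (suc n) = coefficients-scale x ys n

  coefficients-mulP : ∀ xs ys → coefficients (mulP xs ys) ≗ coefficients xs *ₛ coefficients ys
  coefficients-mulP []       ys n       = sym (*ₛ-zeroˡ {0ₛ} (coefficients ys) (λ _ → refl) n)
  coefficients-mulP (x ∷ xs) ys zero    =
    trans (coefficients-addP (map (x F.*_) ys) (0# ∷ mulP xs ys) 0)
          (trans (cong (_⊕ 𝟎) (coefficients-scale x ys 0)) (+-identityʳ _))
  coefficients-mulP (x ∷ xs) ys (suc n) =
    trans (coefficients-addP (map (x F.*_) ys) (0# ∷ mulP xs ys) (suc n))
          (cong₂ _⊕_ (coefficients-scale x ys (suc n)) (coefficients-mulP xs ys n))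

  coefficients-monic : ∀ xs → coefficients (xs ++ [ 1# ]) ≗ ⟦ map index xs ⟧
  coefficients-monic []       zero    = refl
  coefficients-monic []       (suc n) = refl
  coefficients-monic (x ∷ xs) zero    = refl
  coefficients-monic (x ∷ xs) (suc n) = coefficients-monic xs n

  map-index-enum : ∀ r → map index (map enum r) ≡ r
  map-index-enum []      = refl
  map-index-enum (i ∷ r) = cong₂ _∷_ (index-enum i) (map-index-enum r)

  -- A monic factorisation over `F`, read through `index`, becomes a factorisation of words.
  -- `reverse` mediates between the argument of `monic`, highest degree first, and words, lowest
  -- degree first.
  irreducibleMonic : ∀ r → Irreducible r → IrreducibleMonic (reverse (map enum r))
  irreducibleMonic r (1≤r , irr) =
    subst (1 ≤_) (sym (trans (length-reverse (map enum r)) (length-map enum r))) 1≤r ,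
    λ gs hs 1≤gs 1≤hs e → irr (word gs , word hs , 1≤word gs 1≤gs , 1≤word hs 1≤hs , ⟦⟧-injective (product gs hs e))
    where
    word : List Carrier → List (Fin q)
    word gs = map index (reverse gs)
    1≤word : ∀ gs → 1 ≤ length gs → 1 ≤ length (word gs)
    1≤word gs = subst (1 ≤_) (sym (trans (length-map index (reverse gs)) (length-reverse gs)))
    word-r : word (reverse (map enum r)) ≡ r
    word-r = trans (cong (map index) (reverse-involutive (map enum r))) (map-index-enum r)
    product : ∀ gs hs → Pointwise _≈_ (mulP (monic gs) (monic hs)) (monic (reverse (map enum r))) →
              ⟦ word gs ⊗ word hs ⟧ ≗ ⟦ r ⟧
    product gs hs e i = begin
      ⟦ word gs ⊗ word hs ⟧ i                                ≡⟨ ⟦⊗⟧ (word gs) (word hs) i ⟩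
      (⟦ word gs ⟧ *ₛ ⟦ word hs ⟧) i                         ≡⟨ *ₛ-cong (coefficients-monic (reverse gs)) (coefficients-monic (reverse hs)) i ⟨
      (coefficients (monic gs) *ₛ coefficients (monic hs)) i ≡⟨ coefficients-mulP (monic gs) (monic hs) i ⟨
      coefficients (mulP (monic gs) (monic hs)) i            ≡⟨ coefficients-cong e i ⟩
      coefficients (monic (reverse (map enum r))) i          ≡⟨ coefficients-monic (reverse (reverse (map enum r))) i ⟩
      ⟦ word (reverse (map enum r)) ⟧ i                      ≡⟨ cong (λ s → ⟦ s ⟧ i) word-r ⟩
      ⟦ r ⟧ i                                                ∎
      where open ≡-Reasoning

  subleading-∷ʳ : ∀ us z → subleading (us ++ [ z ]) ≡ z
  subleading-∷ʳ []           z = refl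
  subleading-∷ʳ (_ ∷ [])     z = refl
  subleading-∷ʳ (_ ∷ u ∷ us) z = subleading-∷ʳ (u ∷ us) z

  Solution : Carrier → Carrier → ℕ → Set _
  Solution a b n =
    ∃ λ (cs : List Carrier) → ∃ λ (c₁ : Carrier) → ∃ λ (mid : List Carrier) → ∃ λ (cₙ₋₁ : Carrier) → ∃ λ (cₙ : Carrier) →
      (cs ≡ c₁ ∷ mid ++ cₙ₋₁ ∷ cₙ ∷ []) × (length cs ≡ n) × IrreducibleMonic cs ×
      (c₁ ≈ a) × ¬ (cₙ ≈ 0#) × (cₙ₋₁ ≈ b F.* cₙ)

  -- In a word of length n, x and y are the coefficients cₙ and cₙ₋₁, and the last entry z is c₁;
  -- the bound 3 ≤ n keeps z apart from y.
  solution : ∀ {a b n} → 3 ≤ n → Prescribed n (index a , index b) → Solution a b n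
  solution () ([] , _ , refl , _)
  solution (s≤s ()) (_ ∷ [] , _ , refl , _)
  solution {a} {b} 3≤n (x ∷ y ∷ zs , irr , len , nz , cl) with initLast zs
  ... | [] = ⊥-elim (ℕ.<-irrefl len 3≤n)
  ... | us ∷ʳ′ z = cs , enum z , reverse (map enum us) , enum y , enum x , shape ,
        trans (length-reverse (map enum r)) (trans (length-map enum r) len) , irreducibleMonic r irr ,
        F.trans (F.reflexive (cong enum (trans (sym (subleading-∷ʳ (x ∷ y ∷ us) z)) (cong proj₁ cl)))) (enum-index a) ,
        (λ e → nz (trans (sym (index-enum x)) (index-cong e))) ,
        index-injective (begin
          index (enum y)              ≡⟨ index-enum y ⟩
          y                           ≡⟨ *-identityʳ y ⟨
          y ⊙ 𝟏                       ≡⟨ cong (y ⊙_) (trans (*-comm _ _) (⊙-inverseʳ x nz)) ⟨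
          y ⊙ (x ⁻¹ ⊙ x)              ≡⟨ *-assoc _ _ _ ⟨
          y ⊙ x ⁻¹ ⊙ x                ≡⟨ cong₂ _⊙_ (cong proj₂ cl) (sym (index-enum x)) ⟩
          index b ⊙ index (enum x)    ≡⟨ index-* b (enum x) ⟨
          index (b F.* enum x)        ∎)
    where
    open ≡-Reasoning
    r = x ∷ y ∷ us ++ [ z ]
    cs = reverse (map enum r)
    shape : cs ≡ enum z ∷ reverse (map enum us) ++ enum y ∷ enum x ∷ []
    shape = begin
      reverse (enum x ∷ enum y ∷ map enum (us ++ [ z ]))                       ≡⟨ reverse-++ (enum x ∷ enum y ∷ []) (map enum (us ++ [ z ])) ⟩
      reverse (map enum (us ++ [ z ])) ++ enum y ∷ enum x ∷ []                 ≡⟨ cong (λ l → reverse l ++ enum y ∷ enum x ∷ []) (map-++ enum us [ z ]) ⟩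
      reverse (map enum us ++ [ enum z ]) ++ enum y ∷ enum x ∷ []              ≡⟨ cong (_++ enum y ∷ enum x ∷ []) (reverse-++ (map enum us) [ enum z ]) ⟩
      enum z ∷ reverse (map enum us) ++ enum y ∷ enum x ∷ []                   ∎

  theorem : ∀ a b n → Prime n → n ≢ 2 → n ≢ 3 → ¬ (natR (n ^ 2) ≈ a F.* b) → Solution a b n
  theorem a b n pn n≢2 n≢3 n²≉ab = solution (3≤n (prime-cases pn n≢2 n≢3))
    (existence n pn n≢2 n≢3 (index a) (index b) (λ e → n²≉ab (index-injective
      (trans (index-natR (n ^ 2)) (trans e (sym (index-* a b)))))))
    where
    3≤n : ∀ {n} → n ≡ 5 ⊎ (∃[ k ] n ≡ 7 + k) → 3 ≤ n
    3≤n (inj₁ refl)       = s≤s (s≤s (s≤s z≤n))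
    3≤n (inj₂ (k , refl)) = s≤s (s≤s (s≤s z≤n))

theorem6p18 : ∀ {c ℓ} (p h : ℕ) → Prime p → (F : FiniteField c ℓ (p ^ h)) →
    let open FiniteField F in
    let open Poly commRing in
    (a b : Carrier) (n : ℕ) → Prime n → n ≢ 2 → n ≢ 3 →
    ¬ (natR (n ^ 2) ≈ a * b) →
    ∃ λ (cs : List Carrier) → ∃ λ (c₁ : Carrier) → ∃ λ (mid : List Carrier) → ∃ λ (cₙ₋₁ : Carrier) → ∃ λ (cₙ : Carrier) →
    (cs ≡ c₁ ∷ mid ++ cₙ₋₁ ∷ cₙ ∷ []) × (length cs ≡ n) × IrreducibleMonic cs ×
    (c₁ ≈ a) × ¬ (cₙ ≈ 0#) × (cₙ₋₁ ≈ b * cₙ)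
theorem6p18 p h _ F = Transport.theorem F
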